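{- Let $p$ be a prime greater than $3$ and let $t\in D_p$. Then modulo $p$: \begin{align*} \sum_{k=0}^{\lfloor p/3\rfloor}C_k^{(2)}t^k&\equiv 3\left(\frac{p}{3}\right) w_{\lfloor p/3\rfloor}(1-27t/2),\\ \sum_{k=(p-1)/2}^{\lfloor 2p/3\rfloor}C_k^{(2)}t^k&\equiv -\left(\frac{p}{3}\right)\Bigl(w_{\lfloor 2p/3\rfloor}(1-27t/2)+w_{\lfloor p/3\rfloor}(1-27t/2)\Bigr),\\ \sum_{k=0}^{\lfloor p/3\rfloor}\binom{3k}{k} t^k&\equiv \left(\frac{p}{3}\right) w_{\lfloor p/3\rfloor}(27t/2-1),\\ \sum_{k=(p+1)/2}^{\lfloor 2p/3\rfloor}\binom{3k}{k} t^k&\equiv \frac{1}{3}\left(\frac{p}{3}\right)\Bigl(w_{\lfloor 2p/3\rfloor}(27t/2-1)-w_{\lfloor p/3\rfloor}(27t/2-1)\Bigr). \end{align*}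
   Context: $C_n^{(2)}=\frac{1}{2n+1}\binom{3n}{n}$ are the second-order Catalan numbers. The polynomials $w_n(x)$ are defined by $w_0(x)=1$, $w_1(x)=1+2x$, $w_{n+1}(x)=2xw_n(x)-w_{n-1}(x)$. $D_p$ is the set of rationals whose denominator is not divisible by $p$; congruences are in the usual sense. $\left(\frac{p}{3}\right)$ is the Legendre symbol. -}

module Defs where

open import Data.Nat as ℕ using (ℕ; zero; suc; _∸_)
open import Data.Nat.DivMod using (_%_)
open import Data.Nat.Divisibility using (_∣_)
open import Data.Nat.Combinatorics using (_C_)
open import Data.Integer as ℤ using (+_)
open import Data.Rational using (ℚ; ↥_; ↧ₙ_; _/_; _+_; _*_; _-_; 0ℚ; 1ℚ; -_)
open import Relation.Nullary using (¬_)

ℕtoℚ : ℕ → ℚ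
ℕtoℚ n = (+ n) / 1

sumBelow : ℕ → (ℕ → ℚ) → ℚ
sumBelow zero    f = 0ℚ
sumBelow (suc n) f = sumBelow n f + f n

-- Σ_{k=a}^{b} f k  (empty, i.e. 0, if b < a)
sumRange : ℕ → ℕ → (ℕ → ℚ) → ℚ
sumRange a b f = sumBelow (suc b ∸ a) (λ i → f (a ℕ.+ i))

catalan2 : ℕ → ℚ
catalan2 n = (+ ((3 ℕ.* n) C n)) / (suc (2 ℕ.* n))

binom3 : ℕ → ℚ
binom3 k = ℕtoℚ ((3 ℕ.* k) C k)

w : ℕ → ℚ → ℚ
w zero          x = 1ℚ
w (suc zero)    x = 1ℚ + ℕtoℚ 2 * x
w (suc (suc n)) x = ℕtoℚ 2 * x * w (suc n) x - w n x

legendre3 : ℕ → ℚ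
legendre3 p with p % 3
... | 0 = 0ℚ
... | 1 = 1ℚ
... | _ = - 1ℚ

InDp : ℕ → ℚ → Set
InDp p t = ¬ (p ∣ ↧ₙ t)

-- a ≡ b (mod p) for rationals: (a - b)/p ∈ D_p; with a - b in lowest
-- terms this is exactly: p divides the numerator of a - b.
infix 4 _≡_[modℚ_]
_≡_[modℚ_] : ℚ → ℚ → ℕ → Set
a ≡ b [modℚ p ] = p ∣ ℤ.∣ ↥ (a - b) ∣

27t/2 : ℚ → ℚ
27t/2 t = ((+ 27) / 2) * t

infixr 8 _^ℚ_
_^ℚ_ : ℚ → ℕ → ℚ
t ^ℚ zero  = 1ℚ
t ^ℚ suc k = t * (t ^ℚ k)

{-# OPTIONS --safe #-}
-- Put y = 2x − 2 and x = 1 − 27t/2, so y = −27t. Then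
--   w_n(x) = ∑ (2n+1)/(2k+1) C(n+k,2k) y^k   and   w_n(−x) = (−1)^n ∑ C(n+k,2k) y^k,
-- while (2k)! C(n+k,2k) = ∏_{j<k} (n+j+1)(n−j) and (2k)! C(3k,k) = ∏_{j<k} 3(3j+1)(3j+2).
-- The difference −27(n+j+1)(n−j) − 3(3j+1)(3j+2) = −3(3n+1)(3n+2) is divisible by p both for
-- n = ⌊p/3⌋ and for N = ⌊2p/3⌋ = p − 1 − n, so the coefficients agree modulo p as long as (2k)!
-- (or (2k+1)! for the Catalan numbers) is prime to p. Beyond that range the n-coefficients
-- vanish; both products acquire their factor p at j = n, and there the factor for N is
-- 3 times the other one modulo p². Cancelling p against the factorial gives the high-range
-- congruences. The sign is ε = (p/3), through 3(2n+1) = 2p + ε and ε = (−1)^n.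
module Submission where

open import Defs
open import Data.Integer as ℤ using (ℤ; +_)
import Data.Integer.Properties as ℤ
import Data.Integer.Tactic.RingSolver as ℤSolver
open import Data.Maybe using (Maybe; just; nothing)
open import Data.Nat as ℕ using (ℕ; zero; suc; _<_; _≤_; z≤n; s≤s; _!; NonZero; _>_; _∸_)
open import Data.Nat.Combinatorics using (_C_; nCk≡n!/k![n-k]!; k>n⇒nCk≡0; k![n∸k]!∣n!; nCk+nC[k+1]≡[n+1]C[k+1])
open import Data.Nat.Divisibility using (_∣_; divides; >⇒∤; ∣m+n∣m⇒∣n; ∣1⇒≡1; m∣m*n; ∣-refl; ∣n⇒∣m*n; ∣m∣n⇒∣m+n)
open import Data.Nat.DivMod using (m*[n/m]≡n; +-distrib-/-∣ʳ; m<n⇒m/n≡0; m*n/n≡m; m%n<n; m≡m%n+[m/n]*n; [m+kn]%n≡m%n)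
open import Data.Nat.Primality using (Prime; euclidsLemma; prime⇒nonZero; prime⇒irreducible; ¬prime[0]; ¬prime[1])
import Data.Nat.Properties as ℕ
import Data.Nat.Tactic.RingSolver as ℕSolver
open import Data.Product using (∃; _×_; _,_)
open import Data.Rational using (ℚ; ↥_; ↧ₙ_; _/_; _+_; _*_; _-_; -_; 0ℚ; 1ℚ; toℚᵘ)
open import Data.Rational.Properties using (+-*-commutativeRing; _≟_; toℚᵘ-injective; toℚᵘ-fromℚᵘ; toℚᵘ-homo-+; toℚᵘ-homo-*; fromℚᵘ-injective; ↥p/↧p≡p; *-comm; *-zeroˡ; *-zeroʳ; +-identityʳ; *-identityˡ)
import Data.Rational.Unnormalised as ℚᵘ
import Data.Rational.Unnormalised.Properties as ℚᵘ
open import Data.Sum using (_⊎_; inj₁; inj₂; [_,_]′)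
open import Level using (0ℓ)
open import Relation.Binary.PropositionalEquality using (_≡_; refl; sym; trans; cong; cong₂; subst; module ≡-Reasoning)
open import Relation.Nullary using (¬_; yes; no; contradiction)
open import Tactic.RingSolver using (solve-∀)
open import Tactic.RingSolver.Core.AlmostCommutativeRing using (AlmostCommutativeRing; fromCommutativeRing)

open ≡-Reasoning

-- The scale -27 is the one for which -27(n+j+1)(n-j) and 3(3j+1)(3j+2) both have coefficient 27 at
-- j² and at j; this is why their difference is free of j. The index n alone cannot serve the upper
-- ranges, since w_n has degree n < (p-1)/2. The polynomial w_N reaches them but brings terms from
-- below the range. As N ≡ -1-n modulo p, the products for n and N agree modulo p, while 2N+1 ≡
-- -(2n+1). The unwanted terms therefore cancel in w_N + w_n at 1-27t/2 and, n and N having the same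
-- parity, in w_N - w_n at 27t/2-1. The obstacle is division by factorials that contain p: from k =
-- (p-1)/2 on, p divides (2k+1)!, and at that k the formula for the Catalan number has denominator
-- 2k+1 = p. Since p occurs only once there, congruences modulo p² between the products suffice,
-- which calls for divisibility in D_p with a variable modulus.

ℚ-ring : AlmostCommutativeRing 0ℓ 0ℓ
ℚ-ring = fromCommutativeRing +-*-commutativeRing isZero
  where
  isZero : ∀ x → Maybe (0ℚ ≡ x)
  isZero x with 0ℚ ≟ x
  ... | yes 0≡x = just 0≡x
  ... | no  _   = nothing

-- The embedding of ℤ in ℚ

fromℤ : ℤ → ℚ
fromℤ z = z / 1

toℚᵘ-fromℤ : ∀ z → toℚᵘ (fromℤ z) ℚᵘ.≃ ℚᵘ.mkℚᵘ z 0
toℚᵘ-fromℤ z = toℚᵘ-fromℚᵘ (ℚᵘ.mkℚᵘ z 0)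

fromℤ-+ : ∀ a b → fromℤ (a ℤ.+ b) ≡ fromℤ a + fromℤ b
fromℤ-+ a b = toℚᵘ-injective (ℚᵘ.≃-trans (toℚᵘ-fromℤ (a ℤ.+ b)) (ℚᵘ.≃-sym
  (ℚᵘ.≃-trans (toℚᵘ-homo-+ (fromℤ a) (fromℤ b))
  (ℚᵘ.≃-trans (ℚᵘ.+-cong (toℚᵘ-fromℤ a) (toℚᵘ-fromℤ b)) (ℚᵘ.*≡* (identity a b))))))
  where
  identity : ∀ a b → (a ℤ.* + 1 ℤ.+ b ℤ.* + 1) ℤ.* + 1 ≡ (a ℤ.+ b) ℤ.* + 1
  identity = ℤSolver.solve-∀

fromℤ-* : ∀ a b → fromℤ (a ℤ.* b) ≡ fromℤ a * fromℤ b
fromℤ-* a b = toℚᵘ-injective (ℚᵘ.≃-trans (toℚᵘ-fromℤ (a ℤ.* b)) (ℚᵘ.≃-sym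
  (ℚᵘ.≃-trans (toℚᵘ-homo-* (fromℤ a) (fromℤ b)) (ℚᵘ.*-cong (toℚᵘ-fromℤ a) (toℚᵘ-fromℤ b)))))

fromℤ-injective : ∀ {a b} → fromℤ a ≡ fromℤ b → a ≡ b
fromℤ-injective {a} {b} eq with fromℚᵘ-injective {ℚᵘ.mkℚᵘ a 0} {ℚᵘ.mkℚᵘ b 0} eq
... | ℚᵘ.*≡* a*1≡b*1 = trans (sym (ℤ.*-identityʳ a)) (trans a*1≡b*1 (ℤ.*-identityʳ b))

ℕtoℚ-+ : ∀ m n → ℕtoℚ (m ℕ.+ n) ≡ ℕtoℚ m + ℕtoℚ n
ℕtoℚ-+ m n = fromℤ-+ (+ m) (+ n)

ℕtoℚ-* : ∀ m n → ℕtoℚ (m ℕ.* n) ≡ ℕtoℚ m * ℕtoℚ n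
ℕtoℚ-* m n = trans (cong fromℤ (ℤ.pos-* m n)) (fromℤ-* (+ m) (+ n))

ℕtoℚ-suc : ∀ n → ℕtoℚ (suc n) ≡ 1ℚ + ℕtoℚ n
ℕtoℚ-suc n = ℕtoℚ-+ 1 n

/-*-cancel : ∀ a b .{{_ : NonZero b}} → (a / b) * ℕtoℚ b ≡ fromℤ a
/-*-cancel a b@(suc b-1) = toℚᵘ-injective
  (ℚᵘ.≃-trans (toℚᵘ-homo-* (a / b) (ℕtoℚ b))
  (ℚᵘ.≃-trans (ℚᵘ.*-cong (toℚᵘ-fromℚᵘ (ℚᵘ.mkℚᵘ a b-1)) (toℚᵘ-fromℤ (+ b)))
  (ℚᵘ.≃-trans (ℚᵘ.*≡* identity) (ℚᵘ.≃-sym (toℚᵘ-fromℤ a)))))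
  where
  identity : (a ℤ.* + b) ℤ.* + 1 ≡ a ℤ.* + (b ℕ.* 1)
  identity = trans (ℤ.*-identityʳ (a ℤ.* + b)) (cong (λ c → a ℤ.* + c) (sym (ℕ.*-identityʳ b)))

↥-↧ : ∀ q → q * ℕtoℚ (↧ₙ q) ≡ fromℤ (↥ q)
↥-↧ q@record{} = trans (cong (_* ℕtoℚ (↧ₙ q)) (sym (↥p/↧p≡p q))) (/-*-cancel (↥ q) (↧ₙ q))

ℕtoℚ-*-cancelˡ : ∀ n .{{_ : NonZero n}} {x y} → ℕtoℚ n * x ≡ ℕtoℚ n * y → x ≡ y
ℕtoℚ-*-cancelˡ n {x} {y} eq = begin
  x                              ≡⟨ unfold x ⟩
  ((+ 1) / n) * (ℕtoℚ n * x)     ≡⟨ cong (((+ 1) / n) *_) eq ⟩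
  ((+ 1) / n) * (ℕtoℚ n * y)     ≡⟨ unfold y ⟨
  y                              ∎
  where
  assoc : ∀ a b c → (a * b) * c ≡ a * (b * c)
  assoc = solve-∀ ℚ-ring
  unfold : ∀ z → z ≡ ((+ 1) / n) * (ℕtoℚ n * z)
  unfold z = trans (sym (*-identityˡ z))
    (trans (cong (_* z) (sym (/-*-cancel (+ 1) n))) (assoc ((+ 1) / n) (ℕtoℚ n) z))

-- Sums

sumBelow-cong : ∀ K {f g : ℕ → ℚ} → (∀ k → k < K → f k ≡ g k) → sumBelow K f ≡ sumBelow K g
sumBelow-cong zero    eq = refl
sumBelow-cong (suc K) eq =
  cong₂ _+_ (sumBelow-cong K (λ k k<K → eq k (ℕ.m<n⇒m<1+n k<K))) (eq K ℕ.≤-refl)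

sumBelow-zero : ∀ K {f : ℕ → ℚ} → (∀ k → f k ≡ 0ℚ) → sumBelow K f ≡ 0ℚ
sumBelow-zero zero    eq = refl
sumBelow-zero (suc K) eq = cong₂ _+_ (sumBelow-zero K eq) (eq K)

sumBelow-linear : ∀ K c (f g : ℕ → ℚ) →
  sumBelow K (λ k → f k + c * g k) ≡ sumBelow K f + c * sumBelow K g
sumBelow-linear zero    c f g = base c
  where
  base : ∀ c → 0ℚ ≡ 0ℚ + c * 0ℚ
  base = solve-∀ ℚ-ring
sumBelow-linear (suc K) c f g =
  trans (cong (_+ (f K + c * g K)) (sumBelow-linear K c f g)) (step c (f K) (g K) (sumBelow K f) (sumBelow K g))
  where
  step : ∀ c a b s t → (s + c * t) + (a + c * b) ≡ (s + a) + c * (t + b)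
  step = solve-∀ ℚ-ring

sumBelow-split : ∀ a b (f : ℕ → ℚ) →
  sumBelow (a ℕ.+ b) f ≡ sumBelow a f + sumBelow b (λ i → f (a ℕ.+ i))
sumBelow-split a zero    f rewrite ℕ.+-identityʳ a = sym (+-identityʳ (sumBelow a f))
sumBelow-split a (suc b) f rewrite ℕ.+-suc a b =
  trans (cong (_+ f (a ℕ.+ b)) (sumBelow-split a b f))
        (assoc (sumBelow a f) (sumBelow b (λ i → f (a ℕ.+ i))) (f (a ℕ.+ b)))
  where
  assoc : ∀ x y z → (x + y) + z ≡ x + (y + z)
  assoc = solve-∀ ℚ-ring

sumBelow-head : ∀ K (f : ℕ → ℚ) → sumBelow (suc K) f ≡ f 0 + sumBelow K (λ k → f (suc k))
sumBelow-head K f = trans (sumBelow-split 1 K f) (cong (_+ sumBelow K (λ k → f (suc k))) (identityˡ (f 0)))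
  where
  identityˡ : ∀ x → 0ℚ + x ≡ x
  identityˡ = solve-∀ ℚ-ring

-- The bound keeps the truncated length `suc b ∸ a` exact while still admitting the empty range
-- `a = suc b`.
sumBelow-sumRange : ∀ {a b} (f : ℕ → ℚ) → a ≤ suc b →
  sumBelow (suc b) f ≡ sumBelow a f + sumRange a b f
sumBelow-sumRange {a} {b} f a≤1+b =
  trans (cong (λ K → sumBelow K f) (sym (ℕ.m+[n∸m]≡n a≤1+b))) (sumBelow-split a (suc b ∸ a) f)

^ℚ-distrib-* : ∀ x y k → (x * y) ^ℚ k ≡ x ^ℚ k * y ^ℚ k
^ℚ-distrib-* x y zero    = refl
^ℚ-distrib-* x y (suc k) =
  trans (cong (x * y *_) (^ℚ-distrib-* x y k)) (interchange x y (x ^ℚ k) (y ^ℚ k))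
  where
  interchange : ∀ a b c d → a * b * (c * d) ≡ a * c * (b * d)
  interchange = solve-∀ ℚ-ring

-- Divisibility in D_p

module Localisation (p : ℕ) (p-prime : Prime p) where

  instance
    p≢0 : NonZero p
    p≢0 = prime⇒nonZero p-prime

  ∤-* : ∀ {a b} → ¬ p ∣ a → ¬ p ∣ b → ¬ p ∣ a ℕ.* b
  ∤-* {a} {b} p∤a p∤b p∣ab with euclidsLemma a b p-prime p∣ab
  ... | inj₁ p∣a = p∤a p∣a
  ... | inj₂ p∣b = p∤b p∣b

  ∤-1 : ¬ p ∣ 1
  ∤-1 p∣1 = ¬prime[1] (subst Prime (∣1⇒≡1 p∣1) p-prime)

  -- Membership in e·D_p, witnessed by a fraction that need not be in lowest terms, so that sums and
  -- products require no gcd. The denominator is automatically nonzero, because p divides 0. The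
  -- modulus 1 gives D_p itself; p and p² are the moduli of the congruences.
  record Divisible (e : ℕ) (x : ℚ) : Set where
    constructor divisible
    field
      denominator : ℕ
      quotient    : ℤ
      p∤denominator : ¬ p ∣ denominator
      equation    : x * ℕtoℚ denominator ≡ ℕtoℚ e * fromℤ quotient

  div-+ : ∀ {e x y} → Divisible e x → Divisible e y → Divisible e (x + y)
  div-+ {e} {x} {y} (divisible d m p∤d eq) (divisible d′ m′ p∤d′ eq′) =
    divisible (d ℕ.* d′) (m ℤ.* + d′ ℤ.+ m′ ℤ.* + d) (∤-* p∤d p∤d′) (begin
      (x + y) * ℕtoℚ (d ℕ.* d′)
        ≡⟨ cong ((x + y) *_) (ℕtoℚ-* d d′) ⟩
      (x + y) * (ℕtoℚ d * ℕtoℚ d′)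
        ≡⟨ expand x y (ℕtoℚ d) (ℕtoℚ d′) ⟩
      (x * ℕtoℚ d) * ℕtoℚ d′ + (y * ℕtoℚ d′) * ℕtoℚ d
        ≡⟨ cong₂ (λ a b → a * ℕtoℚ d′ + b * ℕtoℚ d) eq eq′ ⟩
      (ℕtoℚ e * fromℤ m) * ℕtoℚ d′ + (ℕtoℚ e * fromℤ m′) * ℕtoℚ d
        ≡⟨ factor (ℕtoℚ e) (fromℤ m) (ℕtoℚ d′) (fromℤ m′) (ℕtoℚ d) ⟩
      ℕtoℚ e * (fromℤ m * ℕtoℚ d′ + fromℤ m′ * ℕtoℚ d)
        ≡⟨ cong (ℕtoℚ e *_) (cong₂ _+_ (fromℤ-* m (+ d′)) (fromℤ-* m′ (+ d))) ⟨
      ℕtoℚ e * (fromℤ (m ℤ.* + d′) + fromℤ (m′ ℤ.* + d))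
        ≡⟨ cong (ℕtoℚ e *_) (fromℤ-+ (m ℤ.* + d′) (m′ ℤ.* + d)) ⟨
      ℕtoℚ e * fromℤ (m ℤ.* + d′ ℤ.+ m′ ℤ.* + d) ∎)
    where
    expand : ∀ x y d d′ → (x + y) * (d * d′) ≡ (x * d) * d′ + (y * d′) * d
    expand = solve-∀ ℚ-ring
    factor : ∀ e m d′ m′ d → (e * m) * d′ + (e * m′) * d ≡ e * (m * d′ + m′ * d)
    factor = solve-∀ ℚ-ring

  div-* : ∀ {e f x y} → Divisible e x → Divisible f y → Divisible (e ℕ.* f) (x * y)
  div-* {e} {f} {x} {y} (divisible d m p∤d eq) (divisible d′ m′ p∤d′ eq′) =
    divisible (d ℕ.* d′) (m ℤ.* m′) (∤-* p∤d p∤d′) (begin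
      x * y * ℕtoℚ (d ℕ.* d′)                   ≡⟨ cong (x * y *_) (ℕtoℚ-* d d′) ⟩
      x * y * (ℕtoℚ d * ℕtoℚ d′)                ≡⟨ interchange x y (ℕtoℚ d) (ℕtoℚ d′) ⟩
      x * ℕtoℚ d * (y * ℕtoℚ d′)                ≡⟨ cong₂ _*_ eq eq′ ⟩
      ℕtoℚ e * fromℤ m * (ℕtoℚ f * fromℤ m′)    ≡⟨ interchange (ℕtoℚ e) (fromℤ m) (ℕtoℚ f) (fromℤ m′) ⟩
      ℕtoℚ e * ℕtoℚ f * (fromℤ m * fromℤ m′)    ≡⟨ cong₂ _*_ (ℕtoℚ-* e f) (fromℤ-* m m′) ⟨
      ℕtoℚ (e ℕ.* f) * fromℤ (m ℤ.* m′)         ∎)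
    where
    interchange : ∀ a b c d → a * b * (c * d) ≡ a * c * (b * d)
    interchange = solve-∀ ℚ-ring

  Integral : ℚ → Set
  Integral = Divisible 1

  integral-fromℤ : ∀ z → Integral (fromℤ z)
  integral-fromℤ z = divisible 1 z ∤-1 (*-comm (fromℤ z) 1ℚ)

  integral-ℕ : ∀ n → Integral (ℕtoℚ n)
  integral-ℕ n = integral-fromℤ (+ n)

  integral-InDp : ∀ {t} → InDp p t → Integral t
  integral-InDp {t} p∤↧t = divisible (↧ₙ t) (↥ t) p∤↧t (trans (↥-↧ t) (sym (*-identityˡ (fromℤ (↥ t)))))

  div-self : ∀ e → Divisible e (ℕtoℚ e)
  div-self e = divisible 1 (+ 1) ∤-1 refl

  div-0 : ∀ {e} → Divisible e 0ℚ
  div-0 {e} = divisible 1 (+ 0) ∤-1 (sym (*-zeroʳ (ℕtoℚ e)))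

  div-scale : ∀ {e c x} → Integral c → Divisible e x → Divisible e (c * x)
  div-scale {e} ic dx = subst (λ f → Divisible f _) (ℕ.*-identityˡ e) (div-* ic dx)

  div-neg : ∀ {e x} → Divisible e x → Divisible e (- x)
  div-neg {e} {x} dx = subst (Divisible e) (neg x) (div-scale (integral-fromℤ (ℤ.- + 1)) dx)
    where
    neg : ∀ x → (- 1ℚ) * x ≡ - x
    neg = solve-∀ ℚ-ring

  div-- : ∀ {e x y} → Divisible e x → Divisible e y → Divisible e (x - y)
  div-- dx dy = div-+ dx (div-neg dy)

  integral-^ : ∀ {t} k → Integral t → Integral (t ^ℚ k)
  integral-^ zero    it = integral-ℕ 1
  integral-^ (suc k) it = div-scale it (integral-^ k it)

  div-sumBelow : ∀ {e} K {f : ℕ → ℚ} → (∀ k → k < K → Divisible e (f k)) → Divisible e (sumBelow K f)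
  div-sumBelow zero    df = div-0
  div-sumBelow (suc K) df =
    div-+ (div-sumBelow K (λ k k<K → df k (ℕ.m<n⇒m<1+n k<K))) (df K ℕ.≤-refl)

  -- The passage from coefficients to sums. The weights are arbitrary rather than powers of t,
  -- because a range starting at l carries the weights t^(l+i).
  div-combination : ∀ {e} K c (f g : ℕ → ℚ) {τ : ℕ → ℚ} → (∀ k → Integral (τ k)) →
    (∀ k → k < K → Divisible e (f k + c * g k)) →
    Divisible e (sumBelow K (λ k → f k * τ k) + c * sumBelow K (λ k → g k * τ k))
  div-combination {e} K c f g {τ} iτ dfg =
    subst (Divisible e) (sumBelow-linear K c (λ k → f k * τ k) (λ k → g k * τ k))
      (div-sumBelow K (λ k k<K → subst (Divisible e) (distrib (τ k) (f k) c (g k)) (div-scale (iτ k) (dfg k k<K))))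
    where
    distrib : ∀ τ f c g → τ * (f + c * g) ≡ f * τ + c * (g * τ)
    distrib = solve-∀ ℚ-ring

  div-cancel-unit : ∀ {e x} u → ¬ p ∣ u → Divisible e (ℕtoℚ u * x) → Divisible e x
  div-cancel-unit {x = x} u p∤u (divisible d m p∤d eq) = divisible (u ℕ.* d) m (∤-* p∤u p∤d)
    (trans (cong (x *_) (ℕtoℚ-* u d)) (trans (rearrange x (ℕtoℚ u) (ℕtoℚ d)) eq))
    where
    rearrange : ∀ x u d → x * (u * d) ≡ u * x * d
    rearrange = solve-∀ ℚ-ring

  div-cancel-p : ∀ {x} → Divisible (p ℕ.* p) (ℕtoℚ p * x) → Divisible p x
  div-cancel-p {x} (divisible d m p∤d eq) = divisible d m p∤d (ℕtoℚ-*-cancelˡ p (begin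
    ℕtoℚ p * (x * ℕtoℚ d)         ≡⟨ assoc (ℕtoℚ p) x (ℕtoℚ d) ⟨
    ℕtoℚ p * x * ℕtoℚ d           ≡⟨ eq ⟩
    ℕtoℚ (p ℕ.* p) * fromℤ m      ≡⟨ cong (_* fromℤ m) (ℕtoℚ-* p p) ⟩
    ℕtoℚ p * ℕtoℚ p * fromℤ m     ≡⟨ assoc (ℕtoℚ p) (ℕtoℚ p) (fromℤ m) ⟩
    ℕtoℚ p * (ℕtoℚ p * fromℤ m)   ∎))
    where
    assoc : ∀ a b c → a * b * c ≡ a * (b * c)
    assoc = solve-∀ ℚ-ring

  -- The bridge to the congruence in the theorem. Clearing both denominators gives an integer
  -- equation whose right side is a multiple of p; Euclid's lemma then discards the denominator d,
  -- which is prime to p.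
  div⇒∣↥ : ∀ {q} → Divisible p q → p ∣ ℤ.∣ ↥ q ∣
  div⇒∣↥ {q} (divisible d m p∤d eq) =
    [ (λ p∣↥q → p∣↥q) , (λ p∣d → contradiction p∣d p∤d) ]′ (euclidsLemma ℤ.∣ ↥ q ∣ d p-prime p∣↥q*d)
    where
    swap : ∀ q a d → (q * a) * d ≡ (q * d) * a
    swap = solve-∀ ℚ-ring

    integer-equation : ↥ q ℤ.* + d ≡ (+ p ℤ.* m) ℤ.* + ↧ₙ q
    integer-equation = fromℤ-injective (begin
      fromℤ (↥ q ℤ.* + d)                   ≡⟨ fromℤ-* (↥ q) (+ d) ⟩
      fromℤ (↥ q) * ℕtoℚ d                  ≡⟨ cong (_* ℕtoℚ d) (↥-↧ q) ⟨
      (q * ℕtoℚ (↧ₙ q)) * ℕtoℚ d            ≡⟨ swap q (ℕtoℚ (↧ₙ q)) (ℕtoℚ d) ⟩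
      (q * ℕtoℚ d) * ℕtoℚ (↧ₙ q)            ≡⟨ cong (_* ℕtoℚ (↧ₙ q)) eq ⟩
      (ℕtoℚ p * fromℤ m) * ℕtoℚ (↧ₙ q)      ≡⟨ cong (_* ℕtoℚ (↧ₙ q)) (fromℤ-* (+ p) m) ⟨
      fromℤ (+ p ℤ.* m) * ℕtoℚ (↧ₙ q)       ≡⟨ fromℤ-* (+ p ℤ.* m) (+ ↧ₙ q) ⟨
      fromℤ ((+ p ℤ.* m) ℤ.* + ↧ₙ q)        ∎)

    p∣↥q*d : p ∣ ℤ.∣ ↥ q ∣ ℕ.* d
    p∣↥q*d = subst (p ∣_) (begin
      p ℕ.* (ℤ.∣ m ∣ ℕ.* ↧ₙ q)              ≡⟨ ℕ.*-assoc p ℤ.∣ m ∣ (↧ₙ q) ⟨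
      p ℕ.* ℤ.∣ m ∣ ℕ.* ↧ₙ q                ≡⟨ cong (ℕ._* ↧ₙ q) (ℤ.abs-* (+ p) m) ⟨
      ℤ.∣ + p ℤ.* m ∣ ℕ.* ↧ₙ q              ≡⟨ ℤ.abs-* (+ p ℤ.* m) (+ ↧ₙ q) ⟨
      ℤ.∣ (+ p ℤ.* m) ℤ.* + ↧ₙ q ∣          ≡⟨ cong ℤ.∣_∣ integer-equation ⟨
      ℤ.∣ ↥ q ℤ.* + d ∣                     ≡⟨ ℤ.abs-* (↥ q) (+ d) ⟩
      ℤ.∣ ↥ q ∣ ℕ.* d                       ∎) (m∣m*n (ℤ.∣ m ∣ ℕ.* ↧ₙ q))

  -- Factorials and their p-part

  p∤small! : ∀ m → m < p → ¬ p ∣ m !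
  p∤small! zero    _   = ∤-1
  p∤small! (suc m) m<p = ∤-* (>⇒∤ m<p) (p∤small! m (ℕ.<-trans (ℕ.n<1+n m) m<p))

  record SimplyDivisible (m : ℕ) : Set where
    constructor simply
    field
      cofactor   : ℕ
      p∤cofactor : ¬ p ∣ cofactor
      equation   : m ≡ p ℕ.* cofactor

  -- The factor p enters with p! itself; each further factor `suc i ℕ.+ p` leaves the nonzero
  -- remainder `suc i` modulo p and only enlarges the cofactor.
  [p+_]!-simply : ∀ i → i < p → SimplyDivisible ((i ℕ.+ p) !)
  [p+ zero ]!-simply  _   = factorial p refl
    where
    factorial : ∀ q → p ≡ q → SimplyDivisible (q !)
    factorial zero    refl = contradiction p-prime ¬prime[0]
    factorial (suc q) refl = simply (q !) (p∤small! q ℕ.≤-refl) refl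
  [p+ suc i ]!-simply i<p with [p+ i ]!-simply (ℕ.<-trans (ℕ.n<1+n i) i<p)
  ... | simply u p∤u eq = simply (suc (i ℕ.+ p) ℕ.* u)
    (∤-* (λ p∣ → >⇒∤ i<p (∣m+n∣m⇒∣n (subst (p ∣_) (ℕ.+-comm (suc i) p) p∣) ∣-refl)) p∤u)
    (trans (cong (suc (i ℕ.+ p) ℕ.*_) eq) (rearrange (suc (i ℕ.+ p)) p u))
    where
    rearrange : ∀ a b c → a ℕ.* (b ℕ.* c) ≡ b ℕ.* (a ℕ.* c)
    rearrange = ℕSolver.solve-∀

  !-simply : ∀ {m} → p ≤ m → m < p ℕ.+ p → SimplyDivisible (m !)
  !-simply {m} p≤m m<2p = subst (λ a → SimplyDivisible (a !)) (ℕ.m∸n+n≡m p≤m)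
    ([p+ m ∸ p ]!-simply (ℕ.+-cancelʳ-< p (m ∸ p) p (subst (ℕ._< p ℕ.+ p) (sym (ℕ.m∸n+n≡m p≤m)) m<2p)))

  div-cancel-!-small : ∀ {e x} m → m < p → Divisible e (ℕtoℚ (m !) * x) → Divisible e x
  div-cancel-!-small m m<p = div-cancel-unit (m !) (p∤small! m m<p)

  -- Here m! contains p exactly once, so cancelling it costs one power of p in the modulus.
  div-cancel-!-medium : ∀ {x} m → p ≤ m → m < p ℕ.+ p →
    Divisible (p ℕ.* p) (ℕtoℚ (m !) * x) → Divisible p x
  div-cancel-!-medium {x} m p≤m m<2p dx with !-simply p≤m m<2p
  ... | simply u p∤u eq = div-cancel-unit u p∤u (div-cancel-p (subst (Divisible (p ℕ.* p))
    (trans (cong (_* x) (trans (cong ℕtoℚ eq) (ℕtoℚ-* p u))) (assoc (ℕtoℚ p) (ℕtoℚ u) x)) dx))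
    where
    assoc : ∀ a b c → a * b * c ≡ a * (b * c)
    assoc = solve-∀ ℚ-ring

-- Expansion of w_n in powers of y = 2x − 2

2*suc : ∀ k → 2 ℕ.* suc k ≡ suc (suc (2 ℕ.* k))
2*suc = ℕSolver.solve-∀

-- These are the Morgan-Voyce polynomials ∑ C(n+k,2k) y^k and ∑ C(n+k,2k+1) y^k. The two recurrences
-- are Pascal's rule for these binomials, read off coefficient by coefficient.
mutual
  S : ℚ → ℕ → ℚ
  S y zero    = 1ℚ
  S y (suc n) = S y n + y * T y (suc n)

  T : ℚ → ℕ → ℚ
  T y zero    = 0ℚ
  T y (suc n) = T y n + S y n

B : ℕ → ℕ → ℚ
B n k = ℕtoℚ ((n ℕ.+ k) C (2 ℕ.* k))

B′ : ℕ → ℕ → ℚ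
B′ n k = ℕtoℚ ((n ℕ.+ k) C suc (2 ℕ.* k))

B-zero : ∀ {n k} → n < k → B n k ≡ 0ℚ
B-zero {n} {k} n<k = cong ℕtoℚ (k>n⇒nCk≡0 (subst (n ℕ.+ k <_) (double k) (ℕ.+-monoˡ-< k n<k)))
  where
  double : ∀ k → k ℕ.+ k ≡ 2 ℕ.* k
  double = ℕSolver.solve-∀

B′-zero : ∀ {n k} → n ≤ k → B′ n k ≡ 0ℚ
B′-zero {n} {k} n≤k = cong ℕtoℚ (k>n⇒nCk≡0 (s≤s (subst (n ℕ.+ k ≤_) (double k) (ℕ.+-monoˡ-≤ k n≤k))))
  where
  double : ∀ k → k ℕ.+ k ≡ 2 ℕ.* k
  double = ℕSolver.solve-∀

C-pascal : ∀ n k → ℕtoℚ (suc n C suc k) ≡ ℕtoℚ (n C k) + ℕtoℚ (n C suc k)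
C-pascal n k = trans (cong ℕtoℚ (sym (nCk+nC[k+1]≡[n+1]C[k+1] n k))) (ℕtoℚ-+ (n C k) (n C suc k))

B′-pascal : ∀ n k → B′ (suc n) k ≡ B n k + B′ n k
B′-pascal n k = C-pascal (n ℕ.+ k) (2 ℕ.* k)

B-pascal : ∀ n k → B (suc n) (suc k) ≡ B′ (suc n) k + B n (suc k)
B-pascal n k = begin
  ℕtoℚ (suc (n ℕ.+ suc k) C (2 ℕ.* suc k))
    ≡⟨ cong (λ j → ℕtoℚ (suc (n ℕ.+ suc k) C j)) (2*suc k) ⟩
  ℕtoℚ (suc (n ℕ.+ suc k) C suc (suc (2 ℕ.* k)))
    ≡⟨ C-pascal (n ℕ.+ suc k) (suc (2 ℕ.* k)) ⟩
  ℕtoℚ ((n ℕ.+ suc k) C suc (2 ℕ.* k)) + ℕtoℚ ((n ℕ.+ suc k) C suc (suc (2 ℕ.* k)))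
    ≡⟨ cong₂ (λ m j → ℕtoℚ (m C suc (2 ℕ.* k)) + ℕtoℚ ((n ℕ.+ suc k) C j)) (ℕ.+-suc n k) (sym (2*suc k)) ⟩
  B′ (suc n) k + B n (suc k) ∎

mutual
  -- The coefficients vanish beyond the degree, so any longer sum is allowed; this lets the
  -- polynomials of indices n and N be expanded over one common range.
  S-expansion : ∀ y n {K} → n < K → sumBelow K (λ k → B n k * y ^ℚ k) ≡ S y n
  S-expansion y zero {suc K} _ = trans (sumBelow-head K (λ k → B 0 k * y ^ℚ k))
    (cong (λ z → 1ℚ + z) (sumBelow-zero K (λ k → trans (cong (_* y ^ℚ suc k) (B-zero {0} {suc k} (s≤s z≤n))) (*-zeroˡ (y ^ℚ suc k)))))
  S-expansion y (suc n) {suc K} (s≤s n<K) = begin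
    sumBelow (suc K) (λ k → B (suc n) k * y ^ℚ k)
      ≡⟨ sumBelow-head K (λ k → B (suc n) k * y ^ℚ k) ⟩
    B (suc n) 0 * 1ℚ + sumBelow K (λ k → B (suc n) (suc k) * (y * y ^ℚ k))
      ≡⟨ cong (λ s → B n 0 * 1ℚ + s)
           (sumBelow-cong K (λ k _ → trans (cong (_* (y * y ^ℚ k)) (B-pascal n k))
                                          (distrib (B′ (suc n) k) (B n (suc k)) y (y ^ℚ k)))) ⟩
    B n 0 * 1ℚ + sumBelow K (λ k → B n (suc k) * (y * y ^ℚ k) + y * (B′ (suc n) k * y ^ℚ k))
      ≡⟨ cong (λ z → B n 0 * 1ℚ + z) (sumBelow-linear K y (λ k → B n (suc k) * (y * y ^ℚ k)) (λ k → B′ (suc n) k * y ^ℚ k)) ⟩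
    B n 0 * 1ℚ + (sumBelow K (λ k → B n (suc k) * (y * y ^ℚ k)) + y * sumBelow K (λ k → B′ (suc n) k * y ^ℚ k))
      ≡⟨ assoc (B n 0 * 1ℚ) (sumBelow K (λ k → B n (suc k) * (y * y ^ℚ k))) (y * sumBelow K (λ k → B′ (suc n) k * y ^ℚ k)) ⟩
    (B n 0 * 1ℚ + sumBelow K (λ k → B n (suc k) * (y * y ^ℚ k))) + y * sumBelow K (λ k → B′ (suc n) k * y ^ℚ k)
      ≡⟨ cong₂ (λ s t → s + y * t)
           (trans (sym (sumBelow-head K (λ k → B n k * y ^ℚ k))) (S-expansion y n (ℕ.m<n⇒m<1+n n<K)))
           (T-expansion y (suc n) n<K) ⟩
    S y n + y * T y (suc n) ∎
    where
    distrib : ∀ a b y z → (a + b) * (y * z) ≡ b * (y * z) + y * (a * z)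
    distrib = solve-∀ ℚ-ring
    assoc : ∀ a b c → a + (b + c) ≡ (a + b) + c
    assoc = solve-∀ ℚ-ring

  T-expansion : ∀ y n {K} → n ≤ K → sumBelow K (λ k → B′ n k * y ^ℚ k) ≡ T y n
  T-expansion y zero {K} _ =
    sumBelow-zero K (λ k → trans (cong (_* y ^ℚ k) (B′-zero {0} {k} z≤n)) (*-zeroˡ (y ^ℚ k)))
  T-expansion y (suc n) {K} n<K = begin
    sumBelow K (λ k → B′ (suc n) k * y ^ℚ k)
      ≡⟨ sumBelow-cong K (λ k _ → trans (cong (_* y ^ℚ k) (B′-pascal n k)) (distrib (B n k) (B′ n k) (y ^ℚ k))) ⟩
    sumBelow K (λ k → B′ n k * y ^ℚ k + 1ℚ * (B n k * y ^ℚ k))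
      ≡⟨ sumBelow-linear K 1ℚ (λ k → B′ n k * y ^ℚ k) (λ k → B n k * y ^ℚ k) ⟩
    sumBelow K (λ k → B′ n k * y ^ℚ k) + 1ℚ * sumBelow K (λ k → B n k * y ^ℚ k)
      ≡⟨ cong₂ (λ t s → t + 1ℚ * s) (T-expansion y n (ℕ.<⇒≤ n<K)) (S-expansion y n n<K) ⟩
    T y n + 1ℚ * S y n
      ≡⟨ cong (λ z → T y n + z) (*-identityˡ (S y n)) ⟩
    T y (suc n) ∎
    where
    distrib : ∀ a b z → (a + b) * z ≡ b * z + 1ℚ * (a * z)
    distrib = solve-∀ ℚ-ring

-- In terms of Chebyshev polynomials of the second kind, `T y n` is U_{n-1}(x) and `S y n` is U_n(x)
-- - U_{n-1}(x), while w_n = U_n + U_{n-1}.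
w-S+2T : ∀ n {x y} → ℕtoℚ 2 * x ≡ ℕtoℚ 2 + y → w n x ≡ S y n + ℕtoℚ 2 * T y n
w-S+2T zero          eq = refl
w-S+2T (suc zero)    {x} {y} eq = trans (cong (λ z → 1ℚ + z) eq) (identity y)
  where
  identity : ∀ y → 1ℚ + (ℕtoℚ 2 + y) ≡ 1ℚ + y * (0ℚ + 1ℚ) + ℕtoℚ 2 * (0ℚ + 1ℚ)
  identity = solve-∀ ℚ-ring
w-S+2T (suc (suc n)) {x} {y} eq = begin
  ℕtoℚ 2 * x * w (suc n) x - w n x
    ≡⟨ cong₂ (λ a b → ℕtoℚ 2 * x * a - b) (w-S+2T (suc n) eq) (w-S+2T n eq) ⟩
  ℕtoℚ 2 * x * (S y (suc n) + ℕtoℚ 2 * T y (suc n)) - (S y n + ℕtoℚ 2 * T y n)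
    ≡⟨ cong (λ c → c * (S y (suc n) + ℕtoℚ 2 * T y (suc n)) - (S y n + ℕtoℚ 2 * T y n)) eq ⟩
  (ℕtoℚ 2 + y) * (S y (suc n) + ℕtoℚ 2 * T y (suc n)) - (S y n + ℕtoℚ 2 * T y n)
    ≡⟨ identity y (S y n) (T y n) ⟩
  S y (suc (suc n)) + ℕtoℚ 2 * T y (suc (suc n)) ∎
  where
  identity : ∀ y s t →
    (ℕtoℚ 2 + y) * ((s + y * (t + s)) + ℕtoℚ 2 * (t + s)) - (s + ℕtoℚ 2 * t) ≡
    ((s + y * (t + s)) + y * ((t + s) + (s + y * (t + s)))) + ℕtoℚ 2 * ((t + s) + (s + y * (t + s)))
  identity = solve-∀ ℚ-ring

-- The point x is now the negative of the one with 2x = 2 + y. By the parity of U_n, the sum U_n +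
-- U_{n-1} becomes (-1)^n times the difference U_n - U_{n-1}.
w-S : ∀ n {x y} → ℕtoℚ 2 * x ≡ - (ℕtoℚ 2 + y) → w n x ≡ (- 1ℚ) ^ℚ n * S y n
w-S zero          eq = refl
w-S (suc zero)    {x} {y} eq = trans (cong (λ z → 1ℚ + z) eq) (identity y)
  where
  identity : ∀ y → 1ℚ + - (ℕtoℚ 2 + y) ≡ - 1ℚ * 1ℚ * (1ℚ + y * (0ℚ + 1ℚ))
  identity = solve-∀ ℚ-ring
w-S (suc (suc n)) {x} {y} eq = begin
  ℕtoℚ 2 * x * w (suc n) x - w n x
    ≡⟨ cong₂ (λ a b → ℕtoℚ 2 * x * a - b) (w-S (suc n) eq) (w-S n eq) ⟩
  ℕtoℚ 2 * x * (- 1ℚ * σ * S y (suc n)) - σ * S y n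
    ≡⟨ cong (λ c → c * (- 1ℚ * σ * S y (suc n)) - σ * S y n) eq ⟩
  - (ℕtoℚ 2 + y) * (- 1ℚ * σ * S y (suc n)) - σ * S y n
    ≡⟨ identity y σ (S y n) (T y n) ⟩
  - 1ℚ * (- 1ℚ * σ) * S y (suc (suc n)) ∎
  where
  σ = (- 1ℚ) ^ℚ n
  identity : ∀ y σ s t →
    - (ℕtoℚ 2 + y) * (- 1ℚ * σ * (s + y * (t + s))) - σ * s ≡
    - 1ℚ * (- 1ℚ * σ) * ((s + y * (t + s)) + y * ((t + s) + (s + y * (t + s))))
  identity = solve-∀ ℚ-ring

-- Product formulas for the coefficients

-- In ℚ the difference m - k is not truncated, so there is no side condition k ≤ m. The two
-- absorption rules support each other: Pascal's rule derives the second from the first at the same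
-- m, and the first at `suc m` follows from the rules at m.
C-absorb : ∀ m k → ℕtoℚ (suc k) * ℕtoℚ (m C suc k) ≡ (ℕtoℚ m - ℕtoℚ k) * ℕtoℚ (m C k)
C-absorb-suc : ∀ m k → ℕtoℚ (suc k) * ℕtoℚ (suc m C suc k) ≡ ℕtoℚ (suc m) * ℕtoℚ (m C k)

C-absorb zero    zero    = refl
C-absorb zero    (suc k) = begin
  ℕtoℚ (suc (suc k)) * ℕtoℚ (0 C suc (suc k))   ≡⟨ cong (λ c → ℕtoℚ (suc (suc k)) * ℕtoℚ c) (k>n⇒nCk≡0 {0} {suc (suc k)} (s≤s z≤n)) ⟩
  ℕtoℚ (suc (suc k)) * 0ℚ                       ≡⟨ *-zeroʳ (ℕtoℚ (suc (suc k))) ⟩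
  0ℚ                                            ≡⟨ *-zeroʳ (0ℚ - ℕtoℚ (suc k)) ⟨
  (0ℚ - ℕtoℚ (suc k)) * 0ℚ                      ≡⟨ cong (λ c → (0ℚ - ℕtoℚ (suc k)) * ℕtoℚ c) (k>n⇒nCk≡0 {0} {suc k} (s≤s z≤n)) ⟨
  (0ℚ - ℕtoℚ (suc k)) * ℕtoℚ (0 C suc k)        ∎
C-absorb (suc m) zero    = begin
  1ℚ * ℕtoℚ (suc m C 1)                         ≡⟨ C-absorb-suc m 0 ⟩
  ℕtoℚ (suc m) * ℕtoℚ (m C 0)                   ≡⟨⟩
  ℕtoℚ (suc m) * ℕtoℚ (suc m C 0)               ≡⟨ cong (_* ℕtoℚ (suc m C 0)) (sym (+-identityʳ (ℕtoℚ (suc m)))) ⟩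
  (ℕtoℚ (suc m) - 0ℚ) * ℕtoℚ (suc m C 0)        ∎
C-absorb (suc m) (suc k) = begin
  ℕtoℚ (suc (suc k)) * ℕtoℚ (suc m C suc (suc k))
    ≡⟨ C-absorb-suc m (suc k) ⟩
  ℕtoℚ (suc m) * c′
    ≡⟨ cong (_* c′) (ℕtoℚ-suc m) ⟩
  (1ℚ + ℕtoℚ m) * c′
    ≡⟨ split (ℕtoℚ m) (ℕtoℚ k) c′ ⟩
  (1ℚ + ℕtoℚ k) * c′ + (ℕtoℚ m - ℕtoℚ k) * c′
    ≡⟨ cong (_+ (ℕtoℚ m - ℕtoℚ k) * c′) (trans (cong (_* c′) (sym (ℕtoℚ-suc k))) (C-absorb m k)) ⟩
  (ℕtoℚ m - ℕtoℚ k) * c + (ℕtoℚ m - ℕtoℚ k) * c′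
    ≡⟨ join (ℕtoℚ m) (ℕtoℚ k) c c′ ⟩
  ((1ℚ + ℕtoℚ m) - (1ℚ + ℕtoℚ k)) * (c + c′)
    ≡⟨ cong₂ (λ a b → (a - b) * (c + c′)) (ℕtoℚ-suc m) (ℕtoℚ-suc k) ⟨
  (ℕtoℚ (suc m) - ℕtoℚ (suc k)) * (c + c′)
    ≡⟨ cong ((ℕtoℚ (suc m) - ℕtoℚ (suc k)) *_) (C-pascal m k) ⟨
  (ℕtoℚ (suc m) - ℕtoℚ (suc k)) * ℕtoℚ (suc m C suc k) ∎
  where
  c  = ℕtoℚ (m C k)
  c′ = ℕtoℚ (m C suc k)
  split : ∀ m k c → (1ℚ + m) * c ≡ (1ℚ + k) * c + (m - k) * c
  split = solve-∀ ℚ-ring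
  join : ∀ m k c d → (m - k) * c + (m - k) * d ≡ ((1ℚ + m) - (1ℚ + k)) * (c + d)
  join = solve-∀ ℚ-ring

C-absorb-suc m k = begin
  ℕtoℚ (suc k) * ℕtoℚ (suc m C suc k)                         ≡⟨ cong (ℕtoℚ (suc k) *_) (C-pascal m k) ⟩
  ℕtoℚ (suc k) * (c + ℕtoℚ (m C suc k))                       ≡⟨ distrib (ℕtoℚ (suc k)) c (ℕtoℚ (m C suc k)) ⟩
  ℕtoℚ (suc k) * c + ℕtoℚ (suc k) * ℕtoℚ (m C suc k)          ≡⟨ cong₂ (λ a b → a * c + b) (ℕtoℚ-suc k) (C-absorb m k) ⟩
  (1ℚ + ℕtoℚ k) * c + (ℕtoℚ m - ℕtoℚ k) * c                   ≡⟨ join (ℕtoℚ m) (ℕtoℚ k) c ⟩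
  (1ℚ + ℕtoℚ m) * c                                           ≡⟨ cong (_* c) (ℕtoℚ-suc m) ⟨
  ℕtoℚ (suc m) * c                                            ∎
  where
  c = ℕtoℚ (m C k)
  distrib : ∀ a b c → a * (b + c) ≡ a * b + a * c
  distrib = solve-∀ ℚ-ring
  join : ∀ m k c → (1ℚ + k) * c + (m - k) * c ≡ (1ℚ + m) * c
  join = solve-∀ ℚ-ring

-27ℚ : ℚ
-27ℚ = - ℕtoℚ 27

R : ℚ → ℕ → ℚ
R z zero    = 1ℚ
R z (suc k) = -27ℚ * (z + ℕtoℚ k + 1ℚ) * (z - ℕtoℚ k) * R z k

-- This is (3k)!/k!. Of the three new factors of (3k+3)!, the factor 3k+3 leaves its 3 here and
-- gives k+1 to the factorial in the denominator.
Q : ℕ → ℕ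
Q zero    = 1
Q (suc k) = 3 ℕ.* (3 ℕ.* k ℕ.+ 1) ℕ.* (3 ℕ.* k ℕ.+ 2) ℕ.* Q k

Q-suc : ∀ k → ℕtoℚ (Q (suc k)) ≡
  ℕtoℚ 3 * (ℕtoℚ 3 * ℕtoℚ k + 1ℚ) * (ℕtoℚ 3 * ℕtoℚ k + ℕtoℚ 2) * ℕtoℚ (Q k)
Q-suc k = begin
  ℕtoℚ (3 ℕ.* a ℕ.* b ℕ.* Q k)                  ≡⟨ ℕtoℚ-* (3 ℕ.* a ℕ.* b) (Q k) ⟩
  ℕtoℚ (3 ℕ.* a ℕ.* b) * ℕtoℚ (Q k)             ≡⟨ cong (_* ℕtoℚ (Q k)) (ℕtoℚ-* (3 ℕ.* a) b) ⟩
  ℕtoℚ (3 ℕ.* a) * ℕtoℚ b * ℕtoℚ (Q k)          ≡⟨ cong (λ c → c * ℕtoℚ b * ℕtoℚ (Q k)) (ℕtoℚ-* 3 a) ⟩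
  ℕtoℚ 3 * ℕtoℚ a * ℕtoℚ b * ℕtoℚ (Q k)         ≡⟨ cong₂ (λ c d → ℕtoℚ 3 * c * d * ℕtoℚ (Q k)) (3k+ 1) (3k+ 2) ⟩
  ℕtoℚ 3 * (ℕtoℚ 3 * ℕtoℚ k + 1ℚ) * (ℕtoℚ 3 * ℕtoℚ k + ℕtoℚ 2) * ℕtoℚ (Q k) ∎
  where
  a = 3 ℕ.* k ℕ.+ 1
  b = 3 ℕ.* k ℕ.+ 2
  3k+_ : ∀ r → ℕtoℚ (3 ℕ.* k ℕ.+ r) ≡ ℕtoℚ 3 * ℕtoℚ k + ℕtoℚ r
  3k+ r = trans (ℕtoℚ-+ (3 ℕ.* k) r) (cong (_+ ℕtoℚ r) (ℕtoℚ-* 3 k))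

[3k]!≡k!*Q : ∀ k → (3 ℕ.* k) ! ≡ k ! ℕ.* Q k
[3k]!≡k!*Q zero    = refl
[3k]!≡k!*Q (suc k) = begin
  (3 ℕ.* suc k) !
    ≡⟨ cong _! (3*suc k) ⟩
  suc (suc (suc m)) ℕ.* (suc (suc m) ℕ.* (suc m ℕ.* m !))
    ≡⟨ cong (λ f → suc (suc (suc m)) ℕ.* (suc (suc m) ℕ.* (suc m ℕ.* f))) ([3k]!≡k!*Q k) ⟩
  suc (suc (suc m)) ℕ.* (suc (suc m) ℕ.* (suc m ℕ.* (k ! ℕ.* Q k)))
    ≡⟨ identity k (k !) (Q k) ⟩
  suc k ! ℕ.* Q (suc k) ∎
  where
  m = 3 ℕ.* k
  3*suc : ∀ k → 3 ℕ.* suc k ≡ suc (suc (suc (3 ℕ.* k)))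
  3*suc = ℕSolver.solve-∀
  identity : ∀ k f q →
    suc (suc (suc (3 ℕ.* k))) ℕ.* (suc (suc (3 ℕ.* k)) ℕ.* (suc (3 ℕ.* k) ℕ.* (f ℕ.* q))) ≡
    (suc k ℕ.* f) ℕ.* (3 ℕ.* (3 ℕ.* k ℕ.+ 1) ℕ.* (3 ℕ.* k ℕ.+ 2) ℕ.* q)
  identity = ℕSolver.solve-∀

[2k]!*C≡Q : ∀ k → (2 ℕ.* k) ! ℕ.* ((3 ℕ.* k) C k) ≡ Q k
[2k]!*C≡Q k = ℕ.*-cancelˡ-≡ _ _ (k !) (begin
  k ! ℕ.* ((2 ℕ.* k) ! ℕ.* ((3 ℕ.* k) C k))     ≡⟨ ℕ.*-assoc (k !) ((2 ℕ.* k) !) _ ⟨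
  -- `3 ℕ.* k` unfolds to `k ℕ.+ 2 ℕ.* k`, so `3 ℕ.* k ∸ k` is 2k.
  (k ! ℕ.* (2 ℕ.* k) !) ℕ.* ((3 ℕ.* k) C k)     ≡⟨ cong (λ j → (k ! ℕ.* j !) ℕ.* ((3 ℕ.* k) C k)) (ℕ.m+n∸m≡n k (2 ℕ.* k)) ⟨
  d ℕ.* ((3 ℕ.* k) C k)                         ≡⟨ cong (d ℕ.*_) (nCk≡n!/k![n-k]! k≤3k) ⟩
  d ℕ.* ((3 ℕ.* k) ! ℕ./ d)                     ≡⟨ m*[n/m]≡n (k![n∸k]!∣n! k≤3k) ⟩
  (3 ℕ.* k) !                                   ≡⟨ [3k]!≡k!*Q k ⟩
  k ! ℕ.* Q k                                   ∎)
  where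
  d = k ! ℕ.* (3 ℕ.* k ∸ k) !
  k≤3k : k ≤ 3 ℕ.* k
  k≤3k = ℕ.m≤m+n k (2 ℕ.* k)
  instance
    _ = k ℕ.!≢0
    _ = k ℕ.!* (3 ℕ.* k ∸ k) !≢0

[2k]!*binom3≡Q : ∀ k → ℕtoℚ ((2 ℕ.* k) !) * binom3 k ≡ ℕtoℚ (Q k)
[2k]!*binom3≡Q k = trans (sym (ℕtoℚ-* ((2 ℕ.* k) !) ((3 ℕ.* k) C k))) (cong ℕtoℚ ([2k]!*C≡Q k))

-- The extra factor 2k+1 of the factorial removes the denominator of the Catalan number, so both
-- kinds of sums are governed by the same product.
[2k+1]!*catalan2≡Q : ∀ k → ℕtoℚ (suc (2 ℕ.* k) !) * catalan2 k ≡ ℕtoℚ (Q k)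
[2k+1]!*catalan2≡Q k = begin
  ℕtoℚ (suc (2 ℕ.* k) !) * catalan2 k                          ≡⟨ cong (_* catalan2 k) (ℕtoℚ-* (suc (2 ℕ.* k)) ((2 ℕ.* k) !)) ⟩
  ℕtoℚ (suc (2 ℕ.* k)) * ℕtoℚ ((2 ℕ.* k) !) * catalan2 k       ≡⟨ rearrange (ℕtoℚ (suc (2 ℕ.* k))) (ℕtoℚ ((2 ℕ.* k) !)) (catalan2 k) ⟩
  ℕtoℚ ((2 ℕ.* k) !) * (catalan2 k * ℕtoℚ (suc (2 ℕ.* k)))     ≡⟨ cong (ℕtoℚ ((2 ℕ.* k) !) *_) (/-*-cancel (+ ((3 ℕ.* k) C k)) (suc (2 ℕ.* k))) ⟩
  ℕtoℚ ((2 ℕ.* k) !) * binom3 k                                ≡⟨ [2k]!*binom3≡Q k ⟩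
  ℕtoℚ (Q k)                                                   ∎
  where
  rearrange : ∀ a b c → a * b * c ≡ b * (c * a)
  rearrange = solve-∀ ℚ-ring

-- The coefficients of tᵏ in (−1)ⁿ w_n(27t/2 − 1) and in w_n(1 − 27t/2).
b : ℕ → ℕ → ℚ
b n k = B n k * -27ℚ ^ℚ k

a : ℕ → ℕ → ℚ
a n k = (B n k + ℕtoℚ 2 * B′ n k) * -27ℚ ^ℚ k

-- One absorption lowers both entries of C(n+k+1,2k+2), a second one only the lower index. They
-- release n+k+1 and n-k, the factors that appear in `R`.
[2k+1]*[2k+2]*B : ∀ n k →
  ℕtoℚ (suc (suc (2 ℕ.* k))) * ℕtoℚ (suc (2 ℕ.* k)) * B n (suc k) ≡
  (ℕtoℚ n + ℕtoℚ k + 1ℚ) * (ℕtoℚ n - ℕtoℚ k) * B n k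
[2k+1]*[2k+2]*B n k = begin
  ℕtoℚ (suc (suc i)) * ℕtoℚ (suc i) * ℕtoℚ ((n ℕ.+ suc k) C (2 ℕ.* suc k))
    ≡⟨ cong₂ (λ u v → ℕtoℚ (suc (suc i)) * ℕtoℚ (suc i) * ℕtoℚ (u C v)) (ℕ.+-suc n k) (2*suc k) ⟩
  ℕtoℚ (suc (suc i)) * ℕtoℚ (suc i) * ℕtoℚ (suc m C suc (suc i))
    ≡⟨ swap (ℕtoℚ (suc (suc i))) (ℕtoℚ (suc i)) (ℕtoℚ (suc m C suc (suc i))) ⟩
  ℕtoℚ (suc i) * (ℕtoℚ (suc (suc i)) * ℕtoℚ (suc m C suc (suc i)))
    ≡⟨ cong (ℕtoℚ (suc i) *_) (C-absorb-suc m (suc i)) ⟩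
  ℕtoℚ (suc i) * (ℕtoℚ (suc m) * ℕtoℚ (m C suc i))
    ≡⟨ swap′ (ℕtoℚ (suc i)) (ℕtoℚ (suc m)) (ℕtoℚ (m C suc i)) ⟩
  ℕtoℚ (suc m) * (ℕtoℚ (suc i) * ℕtoℚ (m C suc i))
    ≡⟨ cong (ℕtoℚ (suc m) *_) (C-absorb m i) ⟩
  ℕtoℚ (suc m) * ((ℕtoℚ m - ℕtoℚ i) * ℕtoℚ (m C i))
    ≡⟨ cong₂ (λ u v → u * ((ℕtoℚ m - v) * ℕtoℚ (m C i))) (ℕtoℚ-suc m) (ℕtoℚ-* 2 k) ⟩
  (1ℚ + ℕtoℚ m) * ((ℕtoℚ m - ℕtoℚ 2 * ℕtoℚ k) * ℕtoℚ (m C i))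
    ≡⟨ cong (λ u → (1ℚ + u) * ((u - ℕtoℚ 2 * ℕtoℚ k) * ℕtoℚ (m C i))) (ℕtoℚ-+ n k) ⟩
  (1ℚ + (ℕtoℚ n + ℕtoℚ k)) * ((ℕtoℚ n + ℕtoℚ k - ℕtoℚ 2 * ℕtoℚ k) * ℕtoℚ (m C i))
    ≡⟨ identity (ℕtoℚ n) (ℕtoℚ k) (ℕtoℚ (m C i)) ⟩
  (ℕtoℚ n + ℕtoℚ k + 1ℚ) * (ℕtoℚ n - ℕtoℚ k) * ℕtoℚ (m C i) ∎
  where
  i = 2 ℕ.* k
  m = n ℕ.+ k
  swap : ∀ a b c → a * b * c ≡ b * (a * c)
  swap = solve-∀ ℚ-ring
  swap′ : ∀ a b c → a * (b * c) ≡ b * (a * c)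
  swap′ = solve-∀ ℚ-ring
  identity : ∀ n k c → (1ℚ + (n + k)) * ((n + k - ℕtoℚ 2 * k) * c) ≡ (n + k + 1ℚ) * (n - k) * c
  identity = solve-∀ ℚ-ring

[2k]!*b≡R : ∀ n k → ℕtoℚ ((2 ℕ.* k) !) * b n k ≡ R (ℕtoℚ n) k
[2k]!*b≡R n zero    = refl
[2k]!*b≡R n (suc k) = begin
  ℕtoℚ ((2 ℕ.* suc k) !) * (B n (suc k) * (-27ℚ * -27ℚ ^ℚ k))
    ≡⟨ cong (λ j → ℕtoℚ (j !) * (B n (suc k) * (-27ℚ * -27ℚ ^ℚ k))) (2*suc k) ⟩
  ℕtoℚ (suc (suc i) ℕ.* (suc i ℕ.* i !)) * (B n (suc k) * (-27ℚ * -27ℚ ^ℚ k))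
    ≡⟨ cong (_* (B n (suc k) * (-27ℚ * -27ℚ ^ℚ k)))
         (trans (ℕtoℚ-* (suc (suc i)) (suc i ℕ.* i !)) (cong (ℕtoℚ (suc (suc i)) *_) (ℕtoℚ-* (suc i) (i !)))) ⟩
  ℕtoℚ (suc (suc i)) * (ℕtoℚ (suc i) * ℕtoℚ (i !)) * (B n (suc k) * (-27ℚ * -27ℚ ^ℚ k))
    ≡⟨ rearrange (ℕtoℚ (suc (suc i))) (ℕtoℚ (suc i)) (ℕtoℚ (i !)) (B n (suc k)) -27ℚ (-27ℚ ^ℚ k) ⟩
  -27ℚ * (ℕtoℚ (suc (suc i)) * ℕtoℚ (suc i) * B n (suc k)) * (ℕtoℚ (i !) * -27ℚ ^ℚ k)
    ≡⟨ cong (λ c → -27ℚ * c * (ℕtoℚ (i !) * -27ℚ ^ℚ k)) ([2k+1]*[2k+2]*B n k) ⟩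
  -27ℚ * ((ℕtoℚ n + ℕtoℚ k + 1ℚ) * (ℕtoℚ n - ℕtoℚ k) * B n k) * (ℕtoℚ (i !) * -27ℚ ^ℚ k)
    ≡⟨ rearrange′ -27ℚ (ℕtoℚ n + ℕtoℚ k + 1ℚ) (ℕtoℚ n - ℕtoℚ k) (B n k) (ℕtoℚ (i !)) (-27ℚ ^ℚ k) ⟩
  -27ℚ * (ℕtoℚ n + ℕtoℚ k + 1ℚ) * (ℕtoℚ n - ℕtoℚ k) * (ℕtoℚ (i !) * b n k)
    ≡⟨ cong (-27ℚ * (ℕtoℚ n + ℕtoℚ k + 1ℚ) * (ℕtoℚ n - ℕtoℚ k) *_) ([2k]!*b≡R n k) ⟩
  R (ℕtoℚ n) (suc k) ∎
  where
  i = 2 ℕ.* k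
  rearrange : ∀ a b f B c d → a * (b * f) * (B * (c * d)) ≡ c * (a * b * B) * (f * d)
  rearrange = solve-∀ ℚ-ring
  rearrange′ : ∀ c a b B f d → c * (a * b * B) * (f * d) ≡ c * a * b * (f * (B * d))
  rearrange′ = solve-∀ ℚ-ring

-- By absorption (2k+1) B′ = (n-k) B, hence (2k+1)(B + 2B′) = (2k+1+2(n-k)) B = (2n+1) B, and k
-- drops out of the factor.
[2k+1]!*a≡R : ∀ n k → ℕtoℚ (suc (2 ℕ.* k) !) * a n k ≡ (ℕtoℚ 2 * ℕtoℚ n + 1ℚ) * R (ℕtoℚ n) k
[2k+1]!*a≡R n k = begin
  ℕtoℚ (suc i ℕ.* i !) * ((B n k + ℕtoℚ 2 * B′ n k) * c)
    ≡⟨ cong (_* ((B n k + ℕtoℚ 2 * B′ n k) * c)) (ℕtoℚ-* (suc i) (i !)) ⟩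
  ℕtoℚ (suc i) * f * ((B n k + ℕtoℚ 2 * B′ n k) * c)
    ≡⟨ rearrange (ℕtoℚ (suc i)) f (B n k) (B′ n k) c ⟩
  (ℕtoℚ (suc i) * B n k + ℕtoℚ 2 * (ℕtoℚ (suc i) * B′ n k)) * (f * c)
    ≡⟨ cong₂ (λ u v → (u * B n k + ℕtoℚ 2 * v) * (f * c))
         (trans (ℕtoℚ-suc i) (cong (λ z → 1ℚ + z) (ℕtoℚ-* 2 k)))
         (trans (C-absorb (n ℕ.+ k) i) (cong₂ (λ u v → (u - v) * B n k) (ℕtoℚ-+ n k) (ℕtoℚ-* 2 k))) ⟩
  ((1ℚ + ℕtoℚ 2 * ℕtoℚ k) * B n k + ℕtoℚ 2 * ((ℕtoℚ n + ℕtoℚ k - ℕtoℚ 2 * ℕtoℚ k) * B n k)) * (f * c)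
    ≡⟨ identity (ℕtoℚ n) (ℕtoℚ k) (B n k) f c ⟩
  (ℕtoℚ 2 * ℕtoℚ n + 1ℚ) * (f * b n k)
    ≡⟨ cong ((ℕtoℚ 2 * ℕtoℚ n + 1ℚ) *_) ([2k]!*b≡R n k) ⟩
  (ℕtoℚ 2 * ℕtoℚ n + 1ℚ) * R (ℕtoℚ n) k ∎
  where
  i = 2 ℕ.* k
  c = -27ℚ ^ℚ k
  f = ℕtoℚ (i !)
  rearrange : ∀ s f B B′ c → s * f * ((B + ℕtoℚ 2 * B′) * c) ≡ (s * B + ℕtoℚ 2 * (s * B′)) * (f * c)
  rearrange = solve-∀ ℚ-ring
  identity : ∀ n k B f c →
    ((1ℚ + ℕtoℚ 2 * k) * B + ℕtoℚ 2 * ((n + k - ℕtoℚ 2 * k) * B)) * (f * c) ≡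
    (ℕtoℚ 2 * n + 1ℚ) * (f * (B * c))
  identity = solve-∀ ℚ-ring

w[1-27t/2]≡∑ : ∀ n t {K} → n < K → w n (1ℚ - 27t/2 t) ≡ sumBelow K (λ k → a n k * t ^ℚ k)
w[1-27t/2]≡∑ n t {K} n<K = begin
  w n (1ℚ - 27t/2 t)
    ≡⟨ w-S+2T n (double t) ⟩
  S y n + ℕtoℚ 2 * T y n
    ≡⟨ cong₂ (λ s τ → s + ℕtoℚ 2 * τ) (S-expansion y n n<K) (T-expansion y n (ℕ.<⇒≤ n<K)) ⟨
  sumBelow K (λ k → B n k * y ^ℚ k) + ℕtoℚ 2 * sumBelow K (λ k → B′ n k * y ^ℚ k)
    ≡⟨ sumBelow-linear K (ℕtoℚ 2) (λ k → B n k * y ^ℚ k) (λ k → B′ n k * y ^ℚ k) ⟨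
  sumBelow K (λ k → B n k * y ^ℚ k + ℕtoℚ 2 * (B′ n k * y ^ℚ k))
    ≡⟨ sumBelow-cong K (λ k _ →
         trans (cong (λ z → B n k * z + ℕtoℚ 2 * (B′ n k * z)) (^ℚ-distrib-* -27ℚ t k))
               (factor (B n k) (B′ n k) (-27ℚ ^ℚ k) (t ^ℚ k))) ⟩
  sumBelow K (λ k → a n k * t ^ℚ k) ∎
  where
  y = -27ℚ * t
  double : ∀ t → ℕtoℚ 2 * (1ℚ - (+ 27) / 2 * t) ≡ ℕtoℚ 2 + - ℕtoℚ 27 * t
  double = solve-∀ ℚ-ring
  factor : ∀ B B′ c u → B * (c * u) + ℕtoℚ 2 * (B′ * (c * u)) ≡ (B + ℕtoℚ 2 * B′) * c * u
  factor = solve-∀ ℚ-ring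

w[27t/2-1]≡∑ : ∀ n t {K} → n < K →
  w n (27t/2 t - 1ℚ) ≡ (- 1ℚ) ^ℚ n * sumBelow K (λ k → b n k * t ^ℚ k)
w[27t/2-1]≡∑ n t {K} n<K = begin
  w n (27t/2 t - 1ℚ)
    ≡⟨ w-S n (double t) ⟩
  (- 1ℚ) ^ℚ n * S y n
    ≡⟨ cong ((- 1ℚ) ^ℚ n *_) (S-expansion y n n<K) ⟨
  (- 1ℚ) ^ℚ n * sumBelow K (λ k → B n k * y ^ℚ k)
    ≡⟨ cong ((- 1ℚ) ^ℚ n *_) (sumBelow-cong K (λ k _ →
         trans (cong (B n k *_) (^ℚ-distrib-* -27ℚ t k)) (assoc (B n k) (-27ℚ ^ℚ k) (t ^ℚ k)))) ⟩
  (- 1ℚ) ^ℚ n * sumBelow K (λ k → b n k * t ^ℚ k) ∎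
  where
  y = -27ℚ * t
  double : ∀ t → ℕtoℚ 2 * ((+ 27) / 2 * t - 1ℚ) ≡ - (ℕtoℚ 2 + - ℕtoℚ 27 * t)
  double = solve-∀ ℚ-ring
  assoc : ∀ a b c → a * (b * c) ≡ a * b * c
  assoc = solve-∀ ℚ-ring

a-zero : ∀ {n k} → n < k → a n k ≡ 0ℚ
a-zero {n} {k} n<k =
  trans (cong₂ (λ u v → (u + ℕtoℚ 2 * v) * -27ℚ ^ℚ k) (B-zero n<k) (B′-zero (ℕ.<⇒≤ n<k))) (*-zeroˡ (-27ℚ ^ℚ k))

b-zero : ∀ {n k} → n < k → b n k ≡ 0ℚ
b-zero {n} {k} n<k = trans (cong (_* -27ℚ ^ℚ k) (B-zero n<k)) (*-zeroˡ (-27ℚ ^ℚ k))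

-- Congruences between the coefficients

-- Both residue classes of p modulo 6 are treated at once: they enter only through these equations,
-- with h = (p-1)/2 and e the sign (p/3). Keeping e an integer makes its image in ℚ integral at p.
module Congruences
  (p : ℕ) (p-prime : Prime p) (p>3 : 3 < p) (n N h : ℕ) (e : ℤ)
  (p≡2h+1 : p ≡ suc (2 ℕ.* h))
  (p≡n+N+1 : p ≡ suc (n ℕ.+ N))
  (n<h : n < h)
  (e²≡1 : fromℤ e * fromℤ e ≡ 1ℚ)
  (6n+3≡2p+e : ℕtoℚ 3 * (ℕtoℚ 2 * ℕtoℚ n + 1ℚ) ≡ ℕtoℚ 2 * ℕtoℚ p + fromℤ e)
  where

  open Localisation p p-prime

  private
    ε x X P : ℚ
    ε = fromℤ e
    x = ℕtoℚ n
    X = ℕtoℚ N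
    P = ℕtoℚ p

    q : ℕ → ℚ
    q k = ℕtoℚ (Q k)

    div-resp : ∀ {d u v} → u ≡ v → Divisible d u → Divisible d v
    div-resp {d} = subst (Divisible d)

    div-P* : ∀ {u} → Integral u → Divisible p (P * u)
    div-P* {u} iu = div-resp (*-comm u P) (div-scale iu (div-self p))

    int-* : ∀ {u v} → Integral u → Integral v → Integral (u * v)
    int-* = div-scale

    p∤3 : ¬ p ∣ 3
    p∤3 = >⇒∤ p>3

    X≡ : X ≡ P - 1ℚ - x
    X≡ = trans (solve-X x X) (cong (λ z → z - 1ℚ - x) (sym P≡))
      where
      solve-X : ∀ x X → X ≡ (1ℚ + (x + X)) - 1ℚ - x
      solve-X = solve-∀ ℚ-ring
      P≡ : P ≡ 1ℚ + (x + X)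
      P≡ = trans (cong ℕtoℚ p≡n+N+1) (trans (ℕtoℚ-suc (n ℕ.+ N)) (cong (λ z → 1ℚ + z) (ℕtoℚ-+ n N)))

    -- The sign of ε is opposite to the one for n; this is what makes the low coefficients of w_N
    -- and w_n at 1-27t/2 opposite modulo p.
    6N+3≡4p-e : ℕtoℚ 3 * (ℕtoℚ 2 * X + 1ℚ) ≡ ℕtoℚ 4 * P - ε
    6N+3≡4p-e = begin
      ℕtoℚ 3 * (ℕtoℚ 2 * X + 1ℚ)                             ≡⟨ cong (λ z → ℕtoℚ 3 * (ℕtoℚ 2 * z + 1ℚ)) X≡ ⟩
      ℕtoℚ 3 * (ℕtoℚ 2 * (P - 1ℚ - x) + 1ℚ)                  ≡⟨ expand P x ⟩
      ℕtoℚ 6 * P - ℕtoℚ 3 * (ℕtoℚ 2 * x + 1ℚ)                ≡⟨ cong (λ z → ℕtoℚ 6 * P - z) 6n+3≡2p+e ⟩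
      ℕtoℚ 6 * P - (ℕtoℚ 2 * P + ε)                          ≡⟨ collect P ε ⟩
      ℕtoℚ 4 * P - ε                                         ∎
      where
      expand : ∀ P x → ℕtoℚ 3 * (ℕtoℚ 2 * (P - 1ℚ - x) + 1ℚ) ≡ ℕtoℚ 6 * P - ℕtoℚ 3 * (ℕtoℚ 2 * x + 1ℚ)
      expand = solve-∀ ℚ-ring
      collect : ∀ P ε → ℕtoℚ 6 * P - (ℕtoℚ 2 * P + ε) ≡ ℕtoℚ 4 * P - ε
      collect = solve-∀ ℚ-ring

    -- Completing the square gives ((6n+3)² - 1)/4 with 6n+3 = 2p + ε. The exact value matters,
    -- since it is later used modulo p².
    [3n+1][3n+2] : (ℕtoℚ 3 * x + 1ℚ) * (ℕtoℚ 3 * x + ℕtoℚ 2) ≡ P * (P + ε)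
    [3n+1][3n+2] = begin
      (ℕtoℚ 3 * x + 1ℚ) * (ℕtoℚ 3 * x + ℕtoℚ 2)
        ≡⟨ complete x ⟩
      quarter * ((ℕtoℚ 3 * (ℕtoℚ 2 * x + 1ℚ)) * (ℕtoℚ 3 * (ℕtoℚ 2 * x + 1ℚ)) - 1ℚ)
        ≡⟨ cong (λ z → quarter * (z * z - 1ℚ)) 6n+3≡2p+e ⟩
      quarter * ((ℕtoℚ 2 * P + ε) * (ℕtoℚ 2 * P + ε) - 1ℚ)
        ≡⟨ expand P ε ⟩
      P * (P + ε) + quarter * (ε * ε - 1ℚ)
        ≡⟨ cong (λ z → P * (P + ε) + quarter * (z - 1ℚ)) e²≡1 ⟩
      P * (P + ε) + quarter * (1ℚ - 1ℚ)
        ≡⟨ +-identityʳ (P * (P + ε)) ⟩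
      P * (P + ε) ∎
      where
      quarter = (+ 1) / 4
      complete : ∀ x → (ℕtoℚ 3 * x + 1ℚ) * (ℕtoℚ 3 * x + ℕtoℚ 2) ≡
        ((+ 1) / 4) * ((ℕtoℚ 3 * (ℕtoℚ 2 * x + 1ℚ)) * (ℕtoℚ 3 * (ℕtoℚ 2 * x + 1ℚ)) - 1ℚ)
      complete = solve-∀ ℚ-ring
      expand : ∀ P ε → ((+ 1) / 4) * ((ℕtoℚ 2 * P + ε) * (ℕtoℚ 2 * P + ε) - 1ℚ) ≡
        P * (P + ε) + ((+ 1) / 4) * (ε * ε - 1ℚ)
      expand = solve-∀ ℚ-ring

    integral-ε : Integral ε
    integral-ε = integral-fromℤ e

    Factor : ℚ → ℕ → ℚ
    Factor z k = -27ℚ * (z + ℕtoℚ k + 1ℚ) * (z - ℕtoℚ k)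

    integral-Factor : ∀ m k → Integral (Factor (ℕtoℚ m) k)
    integral-Factor m k = int-* (int-* (integral-fromℤ (ℤ.- + 27))
      (div-+ (div-+ (integral-ℕ m) (integral-ℕ k)) (integral-ℕ 1))) (div-- (integral-ℕ m) (integral-ℕ k))

    integral-R : ∀ m k → Integral (R (ℕtoℚ m) k)
    integral-R m zero    = integral-ℕ 1
    integral-R m (suc k) = int-* (integral-Factor m k) (integral-R m k)

    -- Up to the factor -3 this product is the difference between corresponding factors of
    -- `R (ℕtoℚ m)` and `Q`, so the condition makes all of them congruent at once.
    Resonant : ℕ → Set
    Resonant m = Divisible p ((ℕtoℚ 3 * ℕtoℚ m + 1ℚ) * (ℕtoℚ 3 * ℕtoℚ m + ℕtoℚ 2))

    resonant-n : Resonant n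
    resonant-n = div-resp (sym [3n+1][3n+2]) (div-P* (div-+ (integral-ℕ p) integral-ε))

    -- The product (3z+1)(3z+2) is invariant under z ↦ -1-z, and N = p-1-n differs from -1-n by p.
    resonant-N : Resonant N
    resonant-N = div-resp (trans (identity P x) (cong (λ z → (ℕtoℚ 3 * z + 1ℚ) * (ℕtoℚ 3 * z + ℕtoℚ 2)) (sym X≡)))
      (div-+ (div-P* (div-- (int-* (integral-ℕ 9) (integral-ℕ p))
                            (int-* (integral-ℕ 9) (div-+ (int-* (integral-ℕ 2) (integral-ℕ n)) (integral-ℕ 1)))))
             resonant-n)
      where
      identity : ∀ P x →
        P * (ℕtoℚ 9 * P - ℕtoℚ 9 * (ℕtoℚ 2 * x + 1ℚ)) + (ℕtoℚ 3 * x + 1ℚ) * (ℕtoℚ 3 * x + ℕtoℚ 2) ≡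
        (ℕtoℚ 3 * (P - 1ℚ - x) + 1ℚ) * (ℕtoℚ 3 * (P - 1ℚ - x) + ℕtoℚ 2)
      identity = solve-∀ ℚ-ring

    -- The difference of the two factors does not depend on k.
    Factor-Q : ∀ z k r s → Factor z k * r - ℕtoℚ 3 * (ℕtoℚ 3 * ℕtoℚ k + 1ℚ) * (ℕtoℚ 3 * ℕtoℚ k + ℕtoℚ 2) * s ≡
      Factor z k * (r - s) + - ℕtoℚ 3 * s * ((ℕtoℚ 3 * z + 1ℚ) * (ℕtoℚ 3 * z + ℕtoℚ 2))
    Factor-Q z k = identity z (ℕtoℚ k)
      where
      identity : ∀ z k r s → - ℕtoℚ 27 * (z + k + 1ℚ) * (z - k) * r - ℕtoℚ 3 * (ℕtoℚ 3 * k + 1ℚ) * (ℕtoℚ 3 * k + ℕtoℚ 2) * s ≡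
        - ℕtoℚ 27 * (z + k + 1ℚ) * (z - k) * (r - s) + - ℕtoℚ 3 * s * ((ℕtoℚ 3 * z + 1ℚ) * (ℕtoℚ 3 * z + ℕtoℚ 2))
      identity = solve-∀ ℚ-ring

    R≡Q : ∀ m → Resonant m → ∀ k → Divisible p (R (ℕtoℚ m) k - q k)
    R≡Q m res zero    = div-0
    R≡Q m res (suc k) = div-resp
      (sym (trans (cong (λ z → Factor (ℕtoℚ m) k * R (ℕtoℚ m) k - z) (Q-suc k)) (Factor-Q (ℕtoℚ m) k (R (ℕtoℚ m) k) (q k))))
      (div-+ (div-scale (integral-Factor m k) (R≡Q m res k))
             (div-scale (int-* (integral-fromℤ (ℤ.- + 3)) (integral-ℕ (Q k))) res))

    q-suc-n : q (suc n) ≡ P * (ℕtoℚ 3 * (P + ε) * q n)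
    q-suc-n = begin
      q (suc n)                                                                    ≡⟨ Q-suc n ⟩
      ℕtoℚ 3 * (ℕtoℚ 3 * x + 1ℚ) * (ℕtoℚ 3 * x + ℕtoℚ 2) * q n                     ≡⟨ regroup (ℕtoℚ 3 * x + 1ℚ) (ℕtoℚ 3 * x + ℕtoℚ 2) (q n) ⟩
      ℕtoℚ 3 * ((ℕtoℚ 3 * x + 1ℚ) * (ℕtoℚ 3 * x + ℕtoℚ 2)) * q n                   ≡⟨ cong (λ z → ℕtoℚ 3 * z * q n) [3n+1][3n+2] ⟩
      ℕtoℚ 3 * (P * (P + ε)) * q n                                                 ≡⟨ regroup′ P ε (q n) ⟩
      P * (ℕtoℚ 3 * (P + ε) * q n)                                                 ∎
      where
      regroup : ∀ u v s → ℕtoℚ 3 * u * v * s ≡ ℕtoℚ 3 * (u * v) * s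
      regroup = solve-∀ ℚ-ring
      regroup′ : ∀ P ε s → ℕtoℚ 3 * (P * (P + ε)) * s ≡ P * (ℕtoℚ 3 * (P + ε) * s)
      regroup′ = solve-∀ ℚ-ring

    -- The factor of R X at index n contains X + n + 1 = p.
    Factor-N-n : Factor X n ≡ P * (- ℕtoℚ 9 * (P - ε))
    Factor-N-n = begin
      -27ℚ * (X + x + 1ℚ) * (X - x)                                        ≡⟨ cong (λ z → -27ℚ * (z + x + 1ℚ) * (z - x)) X≡ ⟩
      -27ℚ * ((P - 1ℚ - x) + x + 1ℚ) * ((P - 1ℚ - x) - x)                  ≡⟨ expand P x ⟩
      P * (- ℕtoℚ 9 * (ℕtoℚ 3 * P - ℕtoℚ 3 * (ℕtoℚ 2 * x + 1ℚ)))           ≡⟨ cong (λ z → P * (- ℕtoℚ 9 * (ℕtoℚ 3 * P - z))) 6n+3≡2p+e ⟩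
      P * (- ℕtoℚ 9 * (ℕtoℚ 3 * P - (ℕtoℚ 2 * P + ε)))                     ≡⟨ collect P ε ⟩
      P * (- ℕtoℚ 9 * (P - ε))                                             ∎
      where
      expand : ∀ P x → - ℕtoℚ 27 * ((P - 1ℚ - x) + x + 1ℚ) * ((P - 1ℚ - x) - x) ≡
        P * (- ℕtoℚ 9 * (ℕtoℚ 3 * P - ℕtoℚ 3 * (ℕtoℚ 2 * x + 1ℚ)))
      expand = solve-∀ ℚ-ring
      collect : ∀ P ε → P * (- ℕtoℚ 9 * (ℕtoℚ 3 * P - (ℕtoℚ 2 * P + ε))) ≡ P * (- ℕtoℚ 9 * (P - ε))
      collect = solve-∀ ℚ-ring

    p∣q-high : ∀ i → Divisible p (q (i ℕ.+ suc n))
    p∣q-high zero    = div-resp (sym q-suc-n)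
      (div-P* (int-* (int-* (integral-ℕ 3) (div-+ (integral-ℕ p) integral-ε)) (integral-ℕ (Q n))))
    p∣q-high (suc i) = div-resp (sym (ℕtoℚ-* c (Q (i ℕ.+ suc n)))) (div-scale (integral-ℕ c) (p∣q-high i))
      where
      c = 3 ℕ.* (3 ℕ.* (i ℕ.+ suc n) ℕ.+ 1) ℕ.* (3 ℕ.* (i ℕ.+ suc n) ℕ.+ 2)

    -- At the start both terms carry an explicit p from index n, so the congruence of `R X n` and
    -- `q n` modulo p is enough. In each later step `Factor-Q` leaves the correction -9 q_k
    -- (3N+1)(3N+2), in which p divides both q_k and the remaining product; the congruence thus
    -- survives modulo p².
    R≡3Q-high : ∀ i → Divisible (p ℕ.* p) (R X (i ℕ.+ suc n) - ℕtoℚ 3 * q (i ℕ.+ suc n))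
    R≡3Q-high zero    = div-resp
      (sym (trans (cong₂ (λ f s → f * R X n - ℕtoℚ 3 * s) Factor-N-n q-suc-n) (identity P ε (R X n) (q n))))
      (div-* (div-self p) (div-+
        (div-scale (int-* (integral-ℕ 9) (div-- integral-ε (integral-ℕ p))) (R≡Q N resonant-N n))
        (div-P* (int-* (integral-fromℤ (ℤ.- + 18)) (integral-ℕ (Q n))))))
      where
      identity : ∀ P ε r s →
        P * (- ℕtoℚ 9 * (P - ε)) * r - ℕtoℚ 3 * (P * (ℕtoℚ 3 * (P + ε) * s)) ≡
        P * (ℕtoℚ 9 * (ε - P) * (r - s) + P * (- ℕtoℚ 18 * s))
      identity = solve-∀ ℚ-ring
    R≡3Q-high (suc i) = div-resp
      (sym (trans (cong (λ z → Factor X k * R X k - ℕtoℚ 3 * z) (Q-suc k))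
           (trans (pull (Factor X k * R X k) (ℕtoℚ 3 * ℕtoℚ k + 1ℚ) (ℕtoℚ 3 * ℕtoℚ k + ℕtoℚ 2) (q k))
           (trans (Factor-Q X k (R X k) (ℕtoℚ 3 * q k))
                  (cong (λ z → Factor X k * (R X k - ℕtoℚ 3 * q k) + z) (push (q k) ((ℕtoℚ 3 * X + 1ℚ) * (ℕtoℚ 3 * X + ℕtoℚ 2))))))))
      (div-+ (div-scale (integral-Factor N k) (R≡3Q-high i))
             (div-scale (integral-fromℤ (ℤ.- + 9)) (div-* (p∣q-high i) resonant-N)))
      where
      k = i ℕ.+ suc n
      pull : ∀ a u v s → a - ℕtoℚ 3 * (ℕtoℚ 3 * u * v * s) ≡ a - ℕtoℚ 3 * u * v * (ℕtoℚ 3 * s)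
      pull = solve-∀ ℚ-ring
      push : ∀ s c → - ℕtoℚ 3 * (ℕtoℚ 3 * s) * c ≡ - ℕtoℚ 9 * (s * c)
      push = solve-∀ ℚ-ring

    R≡3Q : ∀ {k} → n < k → Divisible (p ℕ.* p) (R X k - ℕtoℚ 3 * q k)
    R≡3Q {k} n<k = subst (λ k → Divisible (p ℕ.* p) (R X k - ℕtoℚ 3 * q k)) (ℕ.m∸n+n≡m n<k) (R≡3Q-high (k ∸ suc n))

    p∣Q : ∀ {k} → n < k → Divisible p (q k)
    p∣Q {k} n<k = subst (λ k → Divisible p (q k)) (ℕ.m∸n+n≡m n<k) (p∣q-high (k ∸ suc n))

  -- The constant 3ε is the inverse of 2n+1 modulo p, because 3(2n+1) ≡ ε and ε² = 1.
  catalan2≡a : ∀ k → suc (2 ℕ.* k) < p → Divisible p (catalan2 k + - (ℕtoℚ 3 * ε) * a n k)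
  catalan2≡a k 2k+1<p = div-cancel-!-small (suc (2 ℕ.* k)) 2k+1<p (div-resp
    (sym (begin
      F * (catalan2 k + - (ℕtoℚ 3 * ε) * a n k)
        ≡⟨ distrib F (catalan2 k) ε (a n k) ⟩
      F * catalan2 k + - (ℕtoℚ 3 * ε) * (F * a n k)
        ≡⟨ cong₂ (λ u v → u + - (ℕtoℚ 3 * ε) * v) ([2k+1]!*catalan2≡Q k) ([2k+1]!*a≡R n k) ⟩
      q k + - (ℕtoℚ 3 * ε) * ((ℕtoℚ 2 * x + 1ℚ) * R x k)
        ≡⟨ regroup (q k) ε (ℕtoℚ 2 * x + 1ℚ) (R x k) ⟩
      q k - ε * (ℕtoℚ 3 * (ℕtoℚ 2 * x + 1ℚ)) * R x k
        ≡⟨ cong (λ z → q k - ε * z * R x k) 6n+3≡2p+e ⟩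
      q k - ε * (ℕtoℚ 2 * P + ε) * R x k
        ≡⟨ expand (q k) ε P (R x k) ⟩
      q k - (ε * ε) * R x k + P * (- ℕtoℚ 2 * ε * R x k)
        ≡⟨ cong (λ z → q k - z * R x k + P * (- ℕtoℚ 2 * ε * R x k)) e²≡1 ⟩
      q k - 1ℚ * R x k + P * (- ℕtoℚ 2 * ε * R x k)
        ≡⟨ cong (_+ P * (- ℕtoℚ 2 * ε * R x k)) (negate (q k) (R x k)) ⟩
      - (R x k - q k) + P * (- ℕtoℚ 2 * ε * R x k) ∎))
    (div-+ (div-neg (R≡Q n resonant-n k))
           (div-P* (int-* (int-* (integral-fromℤ (ℤ.- + 2)) integral-ε) (integral-R n k)))))
    where
    F = ℕtoℚ (suc (2 ℕ.* k) !)
    distrib : ∀ F c ε a → F * (c + - (ℕtoℚ 3 * ε) * a) ≡ F * c + - (ℕtoℚ 3 * ε) * (F * a)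
    distrib = solve-∀ ℚ-ring
    regroup : ∀ s ε u r → s + - (ℕtoℚ 3 * ε) * (u * r) ≡ s - ε * (ℕtoℚ 3 * u) * r
    regroup = solve-∀ ℚ-ring
    expand : ∀ s ε P r → s - ε * (ℕtoℚ 2 * P + ε) * r ≡ s - (ε * ε) * r + P * (- ℕtoℚ 2 * ε * r)
    expand = solve-∀ ℚ-ring
    negate : ∀ s r → s - 1ℚ * r ≡ - (r - s)
    negate = solve-∀ ℚ-ring

  -- After multiplication by 3, a unit since p > 3, the factors 2N+1 and 2n+1 become -ε and ε modulo
  -- p, and the two `R` products are congruent through `q k`.
  aN≡-an : ∀ k → suc (2 ℕ.* k) < p → Divisible p (a N k + 1ℚ * a n k)
  aN≡-an k 2k+1<p = div-cancel-!-small (suc (2 ℕ.* k)) 2k+1<p (div-cancel-unit 3 p∤3 (div-resp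
    (sym (begin
      ℕtoℚ 3 * (F * (a N k + 1ℚ * a n k))
        ≡⟨ distrib F (a N k) (a n k) ⟩
      ℕtoℚ 3 * (F * a N k) + ℕtoℚ 3 * (F * a n k)
        ≡⟨ cong₂ (λ u v → ℕtoℚ 3 * u + ℕtoℚ 3 * v) ([2k+1]!*a≡R N k) ([2k+1]!*a≡R n k) ⟩
      ℕtoℚ 3 * ((ℕtoℚ 2 * X + 1ℚ) * R X k) + ℕtoℚ 3 * ((ℕtoℚ 2 * x + 1ℚ) * R x k)
        ≡⟨ regroup (ℕtoℚ 2 * X + 1ℚ) (R X k) (ℕtoℚ 2 * x + 1ℚ) (R x k) ⟩
      ℕtoℚ 3 * (ℕtoℚ 2 * X + 1ℚ) * R X k + ℕtoℚ 3 * (ℕtoℚ 2 * x + 1ℚ) * R x k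
        ≡⟨ cong₂ (λ u v → u * R X k + v * R x k) 6N+3≡4p-e 6n+3≡2p+e ⟩
      (ℕtoℚ 4 * P - ε) * R X k + (ℕtoℚ 2 * P + ε) * R x k
        ≡⟨ expand P ε (R X k) (R x k) (q k) ⟩
      P * (ℕtoℚ 4 * R X k + ℕtoℚ 2 * R x k) + ε * ((R x k - q k) - (R X k - q k)) ∎))
    (div-+ (div-P* (div-+ (int-* (integral-ℕ 4) (integral-R N k)) (int-* (integral-ℕ 2) (integral-R n k))))
           (div-scale integral-ε (div-- (R≡Q n resonant-n k) (R≡Q N resonant-N k))))))
    where
    F = ℕtoℚ (suc (2 ℕ.* k) !)
    distrib : ∀ F u v → ℕtoℚ 3 * (F * (u + 1ℚ * v)) ≡ ℕtoℚ 3 * (F * u) + ℕtoℚ 3 * (F * v)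
    distrib = solve-∀ ℚ-ring
    regroup : ∀ u r v s → ℕtoℚ 3 * (u * r) + ℕtoℚ 3 * (v * s) ≡ ℕtoℚ 3 * u * r + ℕtoℚ 3 * v * s
    regroup = solve-∀ ℚ-ring
    expand : ∀ P ε r s q → (ℕtoℚ 4 * P - ε) * r + (ℕtoℚ 2 * P + ε) * s ≡
      P * (ℕtoℚ 4 * r + ℕtoℚ 2 * s) + ε * ((s - q) - (r - q))
    expand = solve-∀ ℚ-ring

  -- The term 4p in 3(2N+1) = 4p - ε cannot simply be dropped modulo p²; it disappears because p
  -- also divides `R X k` beyond n. What remains is 3Q - R.
  catalan2≡-aN : ∀ k → n < k → p ≤ suc (2 ℕ.* k) → suc (2 ℕ.* k) < p ℕ.+ p →
    Divisible p (catalan2 k + ε * a N k)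
  catalan2≡-aN k n<k p≤2k+1 2k+1<2p = div-cancel-!-medium (suc (2 ℕ.* k)) p≤2k+1 2k+1<2p
    (div-cancel-unit 3 p∤3 (div-resp
    (sym (begin
      ℕtoℚ 3 * (F * (catalan2 k + ε * a N k))
        ≡⟨ distrib F (catalan2 k) ε (a N k) ⟩
      ℕtoℚ 3 * (F * catalan2 k) + ε * (ℕtoℚ 3 * (F * a N k))
        ≡⟨ cong₂ (λ u v → ℕtoℚ 3 * u + ε * (ℕtoℚ 3 * v)) ([2k+1]!*catalan2≡Q k) ([2k+1]!*a≡R N k) ⟩
      ℕtoℚ 3 * q k + ε * (ℕtoℚ 3 * ((ℕtoℚ 2 * X + 1ℚ) * R X k))
        ≡⟨ regroup (q k) ε (ℕtoℚ 2 * X + 1ℚ) (R X k) ⟩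
      ℕtoℚ 3 * q k + ε * (ℕtoℚ 3 * (ℕtoℚ 2 * X + 1ℚ)) * R X k
        ≡⟨ cong (λ z → ℕtoℚ 3 * q k + ε * z * R X k) 6N+3≡4p-e ⟩
      ℕtoℚ 3 * q k + ε * (ℕtoℚ 4 * P - ε) * R X k
        ≡⟨ expand (q k) ε P (R X k) ⟩
      ℕtoℚ 4 * ε * (P * ((R X k - q k) + q k)) + (ℕtoℚ 3 * q k - (ε * ε) * R X k)
        ≡⟨ cong (λ z → ℕtoℚ 4 * ε * (P * ((R X k - q k) + q k)) + (ℕtoℚ 3 * q k - z * R X k)) e²≡1 ⟩
      ℕtoℚ 4 * ε * (P * ((R X k - q k) + q k)) + (ℕtoℚ 3 * q k - 1ℚ * R X k)
        ≡⟨ cong (λ z → ℕtoℚ 4 * ε * (P * ((R X k - q k) + q k)) + z) (negate (q k) (R X k)) ⟩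
      ℕtoℚ 4 * ε * (P * ((R X k - q k) + q k)) + - (R X k - ℕtoℚ 3 * q k) ∎))
    (div-+ (div-scale (int-* (integral-ℕ 4) integral-ε)
             (div-* (div-self p) (div-+ (R≡Q N resonant-N k) (p∣Q n<k))))
           (div-neg (R≡3Q n<k)))))
    where
    F = ℕtoℚ (suc (2 ℕ.* k) !)
    distrib : ∀ F c ε a → ℕtoℚ 3 * (F * (c + ε * a)) ≡ ℕtoℚ 3 * (F * c) + ε * (ℕtoℚ 3 * (F * a))
    distrib = solve-∀ ℚ-ring
    regroup : ∀ s ε u r → ℕtoℚ 3 * s + ε * (ℕtoℚ 3 * (u * r)) ≡ ℕtoℚ 3 * s + ε * (ℕtoℚ 3 * u) * r
    regroup = solve-∀ ℚ-ring
    expand : ∀ s ε P r → ℕtoℚ 3 * s + ε * (ℕtoℚ 4 * P - ε) * r ≡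
      ℕtoℚ 4 * ε * (P * ((r - s) + s)) + (ℕtoℚ 3 * s - (ε * ε) * r)
    expand = solve-∀ ℚ-ring
    negate : ∀ s r → ℕtoℚ 3 * s - 1ℚ * r ≡ - (r - ℕtoℚ 3 * s)
    negate = solve-∀ ℚ-ring

  binom3≡b : ∀ k → 2 ℕ.* k < p → Divisible p (binom3 k + - 1ℚ * b n k)
  binom3≡b k 2k<p = div-cancel-!-small (2 ℕ.* k) 2k<p (div-resp
    (sym (begin
      F * (binom3 k + - 1ℚ * b n k)              ≡⟨ distrib F (binom3 k) (b n k) ⟩
      - (F * b n k - F * binom3 k)               ≡⟨ cong₂ (λ u v → - (u - v)) ([2k]!*b≡R n k) ([2k]!*binom3≡Q k) ⟩
      - (R x k - q k)                            ∎))
    (div-neg (R≡Q n resonant-n k)))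
    where
    F = ℕtoℚ ((2 ℕ.* k) !)
    distrib : ∀ F u v → F * (u + - 1ℚ * v) ≡ - (F * v - F * u)
    distrib = solve-∀ ℚ-ring

  bN≡bn : ∀ k → 2 ℕ.* k < p → Divisible p (b N k + - 1ℚ * b n k)
  bN≡bn k 2k<p = div-cancel-!-small (2 ℕ.* k) 2k<p (div-resp
    (sym (begin
      F * (b N k + - 1ℚ * b n k)                 ≡⟨ distrib F (b N k) (b n k) ⟩
      F * b N k - F * b n k                      ≡⟨ cong₂ (λ u v → u - v) ([2k]!*b≡R N k) ([2k]!*b≡R n k) ⟩
      R X k - R x k                              ≡⟨ insert (R X k) (R x k) (q k) ⟩
      (R X k - q k) - (R x k - q k)              ∎))
    (div-- (R≡Q N resonant-N k) (R≡Q n resonant-n k)))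
    where
    F = ℕtoℚ ((2 ℕ.* k) !)
    distrib : ∀ F u v → F * (u + - 1ℚ * v) ≡ F * u - F * v
    distrib = solve-∀ ℚ-ring
    insert : ∀ r s q → r - s ≡ (r - q) - (s - q)
    insert = solve-∀ ℚ-ring

  bN≡3binom3 : ∀ k → n < k → p ≤ 2 ℕ.* k → 2 ℕ.* k < p ℕ.+ p →
    Divisible p (b N k + - ℕtoℚ 3 * binom3 k)
  bN≡3binom3 k n<k p≤2k 2k<2p = div-cancel-!-medium (2 ℕ.* k) p≤2k 2k<2p (div-resp
    (sym (begin
      F * (b N k + - ℕtoℚ 3 * binom3 k)          ≡⟨ distrib F (b N k) (binom3 k) ⟩
      F * b N k - ℕtoℚ 3 * (F * binom3 k)        ≡⟨ cong₂ (λ u v → u - ℕtoℚ 3 * v) ([2k]!*b≡R N k) ([2k]!*binom3≡Q k) ⟩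
      R X k - ℕtoℚ 3 * q k                       ∎))
    (R≡3Q n<k))
    where
    F = ℕtoℚ ((2 ℕ.* k) !)
    distrib : ∀ F u v → F * (u + - ℕtoℚ 3 * v) ≡ F * u - ℕtoℚ 3 * (F * v)
    distrib = solve-∀ ℚ-ring

  private
    2k<p : ∀ {k} → k ≤ h → 2 ℕ.* k < p
    2k<p {k} k≤h = subst (2 ℕ.* k <_) (sym p≡2h+1) (s≤s (ℕ.*-monoʳ-≤ 2 k≤h))

    2k+1<p : ∀ {k} → k < h → suc (2 ℕ.* k) < p
    2k+1<p {k} k<h = ℕ.<-trans (ℕ.n<1+n (suc (2 ℕ.* k))) (subst (_< p) (2*suc k) (2k<p k<h))

    2k+1<2p : ∀ {k} → k ≤ N → suc (2 ℕ.* k) < p ℕ.+ p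
    2k+1<2p {k} k≤N = subst (_≤ p ℕ.+ p) (trans (double (suc k)) (2*suc k)) (ℕ.+-mono-≤ k<p k<p)
      where
      double : ∀ j → j ℕ.+ j ≡ 2 ℕ.* j
      double = ℕSolver.solve-∀
      k<p : k < p
      k<p = subst (suc k ≤_) (sym p≡n+N+1) (s≤s (ℕ.≤-trans k≤N (ℕ.m≤n+m N n)))

    h<N : h < N
    h<N = ℕ.+-cancelˡ-< n h N (subst (n ℕ.+ h <_) (trans (double h) (ℕ.suc-injective (trans (sym p≡2h+1) p≡n+N+1)))
            (ℕ.+-monoˡ-< h n<h))
      where
      double : ∀ j → j ℕ.+ j ≡ 2 ℕ.* j
      double = ℕSolver.solve-∀

    n<N : n < N
    n<N = ℕ.<-trans n<h h<N

    range-upper : ∀ l {i} → l ≤ suc N → i < suc N ∸ l → l ℕ.+ i ≤ N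
    range-upper l {i} l≤1+N i<len = ℕ.≤-pred (subst (l ℕ.+ i <_) (ℕ.m+[n∸m]≡n l≤1+N) (ℕ.+-monoʳ-< l i<len))

  -- From the coefficients to the four sums

  module Sums (t : ℚ) (t∈Dp : InDp p t) where

    private
      integral-t^ : ∀ k → Integral (t ^ℚ k)
      integral-t^ k = integral-^ k (integral-InDp t∈Dp)

      ∑< : ℕ → (ℕ → ℚ) → ℚ
      ∑< K f = sumBelow K (λ k → f k * t ^ℚ k)

      ∑[_,_] : ℕ → ℕ → (ℕ → ℚ) → ℚ
      ∑[ l , u ] f = sumRange l u (λ k → f k * t ^ℚ k)

      ∑-zero : ∀ {l} (f : ℕ → ℚ) → (∀ {k} → n < k → f k ≡ 0ℚ) → n < l → ∑[ l , N ] f ≡ 0ℚ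
      ∑-zero {l} f f-zero n<l = sumBelow-zero (suc N ∸ l) (λ i →
        trans (cong (_* t ^ℚ (l ℕ.+ i)) (f-zero (ℕ.<-≤-trans n<l (ℕ.m≤m+n l i)))) (*-zeroˡ (t ^ℚ (l ℕ.+ i))))

      ∑-split : ∀ {l} (f : ℕ → ℚ) → l ≤ suc N → ∑< (suc N) f ≡ ∑< l f + ∑[ l , N ] f
      ∑-split f = sumBelow-sumRange (λ k → f k * t ^ℚ k)

    catalan2-low : ∑[ 0 , n ] catalan2 ≡ ℕtoℚ 3 * ε * w n (1ℚ - 27t/2 t) [modℚ p ]
    catalan2-low = div⇒∣↥ (div-resp
      (sym (trans (cong (λ z → ∑< (suc n) catalan2 - ℕtoℚ 3 * ε * z) (w[1-27t/2]≡∑ n t (ℕ.n<1+n n)))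
                  (identity (∑< (suc n) catalan2) (ℕtoℚ 3 * ε) (∑< (suc n) (a n)))))
      (div-combination (suc n) (- (ℕtoℚ 3 * ε)) catalan2 (a n) integral-t^ (λ k k≤n → catalan2≡a k (2k+1<p (ℕ.≤-trans k≤n n<h)))))
      where
      identity : ∀ s c r → s - c * r ≡ s + - c * r
      identity = solve-∀ ℚ-ring

    -- The split is at h, the first k with p ≤ 2k+1. Below it the coefficients of w_N and w_n
    -- cancel; from h on w_n contributes nothing, since n < h, and w_N alone supplies the sum.
    catalan2-high : ∑[ h , N ] catalan2 ≡ - (ε * (w N (1ℚ - 27t/2 t) + w n (1ℚ - 27t/2 t))) [modℚ p ]
    catalan2-high = div⇒∣↥ (div-resp
      (sym (begin
        s - - (ε * (w N (1ℚ - 27t/2 t) + w n (1ℚ - 27t/2 t)))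
          ≡⟨ cong₂ (λ u v → s - - (ε * (u + v)))
               (trans (w[1-27t/2]≡∑ N t (ℕ.n<1+n N)) (∑-split (a N) h≤1+N))
               (trans (w[1-27t/2]≡∑ n t (ℕ.m<n⇒m<1+n n<N)) (trans (∑-split (a n) h≤1+N)
                 (cong (λ z → ∑< h (a n) + z) (∑-zero (a n) a-zero n<h)))) ⟩
        s - - (ε * ((∑< h (a N) + ∑[ h , N ] (a N)) + (∑< h (a n) + 0ℚ)))
          ≡⟨ identity s ε (∑< h (a N)) (∑[ h , N ] (a N)) (∑< h (a n)) ⟩
        (s + ε * ∑[ h , N ] (a N)) + ε * (∑< h (a N) + 1ℚ * ∑< h (a n)) ∎))
      (div-+
        (div-combination (suc N ∸ h) ε (λ i → catalan2 (h ℕ.+ i)) (λ i → a N (h ℕ.+ i)) (λ i → integral-t^ (h ℕ.+ i)) (λ i i<len →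
          catalan2≡-aN (h ℕ.+ i) (ℕ.<-≤-trans n<h (ℕ.m≤m+n h i))
            (subst (_≤ suc (2 ℕ.* (h ℕ.+ i))) (sym p≡2h+1) (s≤s (ℕ.*-monoʳ-≤ 2 (ℕ.m≤m+n h i))))
            (2k+1<2p (range-upper h h≤1+N i<len))))
        (div-scale integral-ε (div-combination h 1ℚ (a N) (a n) integral-t^ (λ k k<h → aN≡-an k (2k+1<p k<h))))))
      where
      s = ∑[ h , N ] catalan2
      h≤1+N : h ≤ suc N
      h≤1+N = ℕ.<⇒≤ (ℕ.m<n⇒m<1+n h<N)
      identity : ∀ s ε A A′ C → s - - (ε * ((A + A′) + (C + 0ℚ))) ≡ (s + ε * A′) + ε * (A + 1ℚ * C)
      identity = solve-∀ ℚ-ring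

    module _ (sign-n : (- 1ℚ) ^ℚ n ≡ ε) (sign-N : (- 1ℚ) ^ℚ N ≡ ε) where

      private
        w-n : ∀ {K} → n < K → w n (27t/2 t - 1ℚ) ≡ ε * ∑< K (b n)
        w-n {K} n<K = trans (w[27t/2-1]≡∑ n t n<K) (cong (_* ∑< K (b n)) sign-n)

        w-N : ∀ {K} → N < K → w N (27t/2 t - 1ℚ) ≡ ε * ∑< K (b N)
        w-N {K} N<K = trans (w[27t/2-1]≡∑ N t N<K) (cong (_* ∑< K (b N)) sign-N)

      binom3-low : ∑[ 0 , n ] binom3 ≡ ε * w n (27t/2 t - 1ℚ) [modℚ p ]
      binom3-low = div⇒∣↥ (div-resp
        (sym (begin
          s - ε * w n (27t/2 t - 1ℚ)       ≡⟨ cong (λ z → s - ε * z) (w-n (ℕ.n<1+n n)) ⟩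
          s - ε * (ε * r)                  ≡⟨ assoc s ε r ⟩
          s + - (ε * ε) * r                ≡⟨ cong (λ z → s + - z * r) e²≡1 ⟩
          s + - 1ℚ * r                     ∎))
        (div-combination (suc n) (- 1ℚ) binom3 (b n) integral-t^
          (λ k k≤n → binom3≡b k (2k<p (ℕ.<⇒≤ (ℕ.≤-trans k≤n n<h))))))
        where
        s = ∑[ 0 , n ] binom3
        r = ∑< (suc n) (b n)
        assoc : ∀ s ε r → s - ε * (ε * r) ≡ s + - (ε * ε) * r
        assoc = solve-∀ ℚ-ring

      -- The split moves to `suc h`, because the factorial is now (2k)!, which contains p only from
      -- 2k = p+1 on. Multiplying by 3 clears the fraction and matches the ratio 3 between `b N k`
      -- and `binom3 k`.
      binom3-high : ∑[ suc h , N ] binom3 ≡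
        ((+ 1) / 3) * ε * (w N (27t/2 t - 1ℚ) - w n (27t/2 t - 1ℚ)) [modℚ p ]
      binom3-high = div⇒∣↥ (div-cancel-unit {x = s - third * ε * (w N (27t/2 t - 1ℚ) - w n (27t/2 t - 1ℚ))} 3 p∤3 (div-resp
        (sym (begin
          ℕtoℚ 3 * (s - third * ε * (w N (27t/2 t - 1ℚ) - w n (27t/2 t - 1ℚ)))
            ≡⟨ cong₂ (λ u v → ℕtoℚ 3 * (s - third * ε * (u - v)))
                 (trans (w-N (ℕ.n<1+n N)) (cong (ε *_) (∑-split (b N) (s≤s (ℕ.<⇒≤ h<N)))))
                 (trans (w-n (ℕ.m<n⇒m<1+n n<N)) (cong (ε *_) (trans (∑-split (b n) (s≤s (ℕ.<⇒≤ h<N)))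
                   (cong (λ z → ∑< (suc h) (b n) + z) (∑-zero (b n) b-zero (ℕ.m<n⇒m<1+n n<h)))))) ⟩
          ℕtoℚ 3 * (s - third * ε * (ε * (A + A′) - ε * (C′ + 0ℚ)))
            ≡⟨ identity s ε A A′ C′ ⟩
          ℕtoℚ 3 * s - ε * ε * (A + A′ - C′)
            ≡⟨ cong (λ z → ℕtoℚ 3 * s - z * (A + A′ - C′)) e²≡1 ⟩
          ℕtoℚ 3 * s - 1ℚ * (A + A′ - C′)
            ≡⟨ regroup s A A′ C′ ⟩
          - ((A′ + - ℕtoℚ 3 * s) + (A + - 1ℚ * C′)) ∎))
        (div-neg (div-+
          (div-combination (suc N ∸ suc h) (- ℕtoℚ 3) (λ i → b N (suc h ℕ.+ i)) (λ i → binom3 (suc h ℕ.+ i)) (λ i → integral-t^ (suc h ℕ.+ i)) (λ i i<len →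
            bN≡3binom3 (suc h ℕ.+ i) (ℕ.<-≤-trans (ℕ.m<n⇒m<1+n n<h) (ℕ.m≤m+n (suc h) i)) (p≤2k i)
              (ℕ.<-trans (ℕ.n<1+n _) (2k+1<2p (range-upper (suc h) (s≤s (ℕ.<⇒≤ h<N)) i<len)))))
          (div-combination (suc h) (- 1ℚ) (b N) (b n) integral-t^ (λ k k≤h → bN≡bn k (2k<p (ℕ.≤-pred k≤h))))))))
        where
        third = (+ 1) / 3
        s  = ∑[ suc h , N ] binom3
        A  = ∑< (suc h) (b N)
        A′ = ∑[ suc h , N ] (b N)
        C′ = ∑< (suc h) (b n)
        p≤2k : ∀ i → p ≤ 2 ℕ.* (suc h ℕ.+ i)
        p≤2k i = ℕ.≤-trans (ℕ.≤-trans (ℕ.≤-reflexive p≡2h+1) (ℕ.n≤1+n (suc (2 ℕ.* h))))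
          (subst (_≤ 2 ℕ.* (suc h ℕ.+ i)) (2*suc h) (ℕ.*-monoʳ-≤ 2 (ℕ.m≤m+n (suc h) i)))
        identity : ∀ s ε A A′ C → ℕtoℚ 3 * (s - ((+ 1) / 3) * ε * (ε * (A + A′) - ε * (C + 0ℚ))) ≡
          ℕtoℚ 3 * s - ε * ε * (A + A′ - C)
        identity = solve-∀ ℚ-ring
        regroup : ∀ s A A′ C → ℕtoℚ 3 * s - 1ℚ * (A + A′ - C) ≡ - ((A′ + - ℕtoℚ 3 * s) + (A + - 1ℚ * C))
        regroup = solve-∀ ℚ-ring

-- The two residue classes of p modulo 6

/-unique : ∀ {m} d r c .{{_ : NonZero d}} → r < d → m ≡ r ℕ.+ c ℕ.* d → m ℕ./ d ≡ c
/-unique d r c r<d refl = begin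
  (r ℕ.+ c ℕ.* d) ℕ./ d            ≡⟨ +-distrib-/-∣ʳ r (divides c refl) ⟩
  r ℕ./ d ℕ.+ c ℕ.* d ℕ./ d        ≡⟨ cong₂ ℕ._+_ (m<n⇒m/n≡0 r<d) (m*n/n≡m c d) ⟩
  c                                ∎

legendre3≡1 : ∀ p → p ℕ.% 3 ≡ 1 → legendre3 p ≡ 1ℚ
legendre3≡1 p p%3≡1 rewrite p%3≡1 = refl

legendre3≡-1 : ∀ p → p ℕ.% 3 ≡ 2 → legendre3 p ≡ - 1ℚ
legendre3≡-1 p p%3≡2 rewrite p%3≡2 = refl

[-1]^[2k]≡1 : ∀ k → (- 1ℚ) ^ℚ (2 ℕ.* k) ≡ 1ℚ
[-1]^[2k]≡1 zero    = refl
[-1]^[2k]≡1 (suc k) = trans (cong ((- 1ℚ) ^ℚ_) (2*suc k)) (trans (square ((- 1ℚ) ^ℚ (2 ℕ.* k))) ([-1]^[2k]≡1 k))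
  where
  square : ∀ u → - 1ℚ * (- 1ℚ * u) ≡ u
  square = solve-∀ ℚ-ring

[-1]^[2k+1]≡-1 : ∀ k → (- 1ℚ) ^ℚ suc (2 ℕ.* k) ≡ - 1ℚ
[-1]^[2k+1]≡-1 k = cong (- 1ℚ *_) ([-1]^[2k]≡1 k)

prime-∤ : ∀ {p} → Prime p → ∀ {d} → 1 < d → d < p → ¬ d ∣ p
prime-∤ p-prime 1<d d<p d∣p with prime⇒irreducible p-prime d∣p
... | inj₁ refl = ℕ.<-irrefl refl 1<d
... | inj₂ refl = ℕ.<-irrefl refl d<p

prime-mod-6 : ∀ {p} → Prime p → 3 < p → ∃ λ k → p ≡ 1 ℕ.+ k ℕ.* 6 ⊎ p ≡ 5 ℕ.+ k ℕ.* 6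
prime-mod-6 {p} p-prime p>3 = p ℕ./ 6 , cases (p ℕ.% 6) (m%n<n p 6) (m≡m%n+[m/n]*n p 6)
  where
  k = p ℕ./ 6
  2∤p : ¬ 2 ∣ p
  2∤p = prime-∤ p-prime (s≤s (s≤s z≤n)) (ℕ.<-trans (ℕ.n<1+n 2) p>3)
  3∤p : ¬ 3 ∣ p
  3∤p = prime-∤ p-prime (s≤s (s≤s z≤n)) p>3
  6k : ∀ {d} → d ∣ 6 → d ∣ k ℕ.* 6
  6k = ∣n⇒∣m*n k
  cases : ∀ r → r < 6 → p ≡ r ℕ.+ k ℕ.* 6 → p ≡ 1 ℕ.+ k ℕ.* 6 ⊎ p ≡ 5 ℕ.+ k ℕ.* 6
  cases 0 _ eq = contradiction (subst (2 ∣_) (sym eq) (6k (divides 3 refl))) 2∤p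
  cases 1 _ eq = inj₁ eq
  cases 2 _ eq = contradiction (subst (2 ∣_) (sym eq) (∣m∣n⇒∣m+n (divides 1 refl) (6k (divides 3 refl)))) 2∤p
  cases 3 _ eq = contradiction (subst (3 ∣_) (sym eq) (∣m∣n⇒∣m+n (divides 1 refl) (6k (divides 2 refl)))) 3∤p
  cases 4 _ eq = contradiction (subst (2 ∣_) (sym eq) (∣m∣n⇒∣m+n (divides 2 refl) (6k (divides 3 refl)))) 2∤p
  cases 5 _ eq = inj₂ eq
  cases (suc (suc (suc (suc (suc (suc r)))))) r<6 _ = contradiction r<6 (ℕ.m+n≮m 6 r)

-- Floors, halves and the Legendre symbol are free parameters, so the congruences can be proved for
-- explicit expressions in k and then transported.
Congruent : ℕ → ℚ → (n N h h′ : ℕ) → ℚ → Set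
Congruent p t n N h h′ ε =
  (sumRange 0 n (λ k → catalan2 k * (t ^ℚ k))
    ≡ ℕtoℚ 3 * ε * w n (1ℚ - 27t/2 t) [modℚ p ])
  × (sumRange h N (λ k → catalan2 k * (t ^ℚ k))
    ≡ - (ε * (w N (1ℚ - 27t/2 t) + w n (1ℚ - 27t/2 t))) [modℚ p ])
  × (sumRange 0 n (λ k → binom3 k * (t ^ℚ k))
    ≡ ε * w n (27t/2 t - 1ℚ) [modℚ p ])
  × (sumRange h′ N (λ k → binom3 k * (t ^ℚ k))
    ≡ ((+ 1) / 3) * ε * (w N (27t/2 t - 1ℚ) - w n (27t/2 t - 1ℚ)) [modℚ p ])

Congruent-resp : ∀ p t {n n₁ N N₁ h h₁ h′ h′₁ ε ε₁} → n₁ ≡ n → N₁ ≡ N → h₁ ≡ h → h′₁ ≡ h′ → ε₁ ≡ ε →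
  Congruent p t n N h h′ ε → Congruent p t n₁ N₁ h₁ h′₁ ε₁
Congruent-resp p t refl refl refl refl refl c = c

-- For p = 6k+1 both n = 2k and N = 4k are even, and 3(2n+1) = 12k+3 = 2p+1. The indices are written
-- as doubles to make their parity visible.
congruent-1 : ∀ k → Prime (1 ℕ.+ k ℕ.* 6) → 3 < 1 ℕ.+ k ℕ.* 6 → ∀ t → InDp (1 ℕ.+ k ℕ.* 6) t →
  Congruent (1 ℕ.+ k ℕ.* 6) t (2 ℕ.* k) (2 ℕ.* (2 ℕ.* k)) (3 ℕ.* k) (suc (3 ℕ.* k)) 1ℚ
-- k = 0 would mean p = 1; positivity of k is also what gives n = 2k < 3k = h.
congruent-1 zero      _       (s≤s ())
congruent-1 k@(suc _) p-prime p>3 t t∈Dp =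
  catalan2-low , catalan2-high , binom3-low sign-n sign-N , binom3-high sign-n sign-N
  where
  p = 1 ℕ.+ k ℕ.* 6
  sign-n = [-1]^[2k]≡1 k
  sign-N = [-1]^[2k]≡1 (2 ℕ.* k)
  p≡2h+1 : ∀ k → 1 ℕ.+ k ℕ.* 6 ≡ suc (2 ℕ.* (3 ℕ.* k))
  p≡2h+1 = ℕSolver.solve-∀
  p≡n+N+1 : ∀ k → 1 ℕ.+ k ℕ.* 6 ≡ suc (2 ℕ.* k ℕ.+ 2 ℕ.* (2 ℕ.* k))
  p≡n+N+1 = ℕSolver.solve-∀
  6n+3≡2p+1 : ∀ x → ℕtoℚ 3 * (ℕtoℚ 2 * (ℕtoℚ 2 * x) + 1ℚ) ≡ ℕtoℚ 2 * (1ℚ + x * ℕtoℚ 6) + 1ℚ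
  6n+3≡2p+1 = solve-∀ ℚ-ring
  open Congruences p p-prime p>3 (2 ℕ.* k) (2 ℕ.* (2 ℕ.* k)) (3 ℕ.* k) (+ 1)
    (p≡2h+1 k) (p≡n+N+1 k) (ℕ.*-monoˡ-< k (ℕ.n<1+n 2)) refl
    (trans (cong (λ z → ℕtoℚ 3 * (ℕtoℚ 2 * z + 1ℚ)) (ℕtoℚ-* 2 k))
    (trans (6n+3≡2p+1 (ℕtoℚ k))
           (cong (λ z → ℕtoℚ 2 * z + 1ℚ) (sym (trans (ℕtoℚ-suc (k ℕ.* 6)) (cong (λ z → 1ℚ + z) (ℕtoℚ-* k 6)))))))
  open Sums t t∈Dp

-- For p = 6k+5 both n = 2k+1 and N = 4k+3 are odd, and 3(2n+1) = 12k+9 = 2p-1.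
congruent-5 : ∀ k → Prime (5 ℕ.+ k ℕ.* 6) → ∀ t → InDp (5 ℕ.+ k ℕ.* 6) t →
  Congruent (5 ℕ.+ k ℕ.* 6) t (suc (2 ℕ.* k)) (suc (2 ℕ.* suc (2 ℕ.* k))) (2 ℕ.+ 3 ℕ.* k) (3 ℕ.+ 3 ℕ.* k) (- 1ℚ)
congruent-5 k p-prime t t∈Dp =
  catalan2-low , catalan2-high , binom3-low sign-n sign-N , binom3-high sign-n sign-N
  where
  p = 5 ℕ.+ k ℕ.* 6
  sign-n = [-1]^[2k+1]≡-1 k
  sign-N = [-1]^[2k+1]≡-1 (suc (2 ℕ.* k))
  p≡2h+1 : ∀ k → 5 ℕ.+ k ℕ.* 6 ≡ suc (2 ℕ.* (2 ℕ.+ 3 ℕ.* k))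
  p≡2h+1 = ℕSolver.solve-∀
  p≡n+N+1 : ∀ k → 5 ℕ.+ k ℕ.* 6 ≡ suc (suc (2 ℕ.* k) ℕ.+ suc (2 ℕ.* suc (2 ℕ.* k)))
  p≡n+N+1 = ℕSolver.solve-∀
  6n+3≡2p-1 : ∀ x → ℕtoℚ 3 * (ℕtoℚ 2 * (1ℚ + ℕtoℚ 2 * x) + 1ℚ) ≡ ℕtoℚ 2 * (ℕtoℚ 5 + x * ℕtoℚ 6) + - 1ℚ
  6n+3≡2p-1 = solve-∀ ℚ-ring
  open Congruences p p-prime (s≤s (s≤s (s≤s (s≤s z≤n)))) (suc (2 ℕ.* k)) (suc (2 ℕ.* suc (2 ℕ.* k))) (2 ℕ.+ 3 ℕ.* k) (ℤ.- + 1)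
    (p≡2h+1 k) (p≡n+N+1 k) (s≤s (s≤s (ℕ.*-monoˡ-≤ k (ℕ.n≤1+n 2)))) refl
    (trans (cong (λ z → ℕtoℚ 3 * (ℕtoℚ 2 * z + 1ℚ)) (trans (ℕtoℚ-suc (2 ℕ.* k)) (cong (λ z → 1ℚ + z) (ℕtoℚ-* 2 k))))
    (trans (6n+3≡2p-1 (ℕtoℚ k))
           (cong (λ z → ℕtoℚ 2 * z + - 1ℚ) (sym (trans (ℕtoℚ-+ 5 (k ℕ.* 6)) (cong (λ z → ℕtoℚ 5 + z) (ℕtoℚ-* k 6)))))))
  open Sums t t∈Dp

congruent-p%6≡1 : ∀ {p} k → p ≡ 1 ℕ.+ k ℕ.* 6 → Prime p → 3 < p → ∀ t → InDp p t →
  Congruent p t (p ℕ./ 3) ((2 ℕ.* p) ℕ./ 3) ((p ∸ 1) ℕ./ 2) ((p ℕ.+ 1) ℕ./ 2) (legendre3 p)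
congruent-p%6≡1 {p} k refl p-prime p>3 t t∈Dp = Congruent-resp p t
  (/-unique 3 1 (2 ℕ.* k) (s≤s (s≤s z≤n)) (n-eq k))
  (/-unique 3 2 (2 ℕ.* (2 ℕ.* k)) (s≤s (s≤s (s≤s z≤n))) (N-eq k))
  (/-unique 2 0 (3 ℕ.* k) (s≤s z≤n) (h-eq k))
  (/-unique 2 0 (suc (3 ℕ.* k)) (s≤s z≤n) (h′-eq k))
  (legendre3≡1 p (trans (cong (ℕ._% 3) (n-eq k)) ([m+kn]%n≡m%n 1 (2 ℕ.* k) 3)))
  (congruent-1 k p-prime p>3 t t∈Dp)
  where
  n-eq : ∀ k → 1 ℕ.+ k ℕ.* 6 ≡ 1 ℕ.+ (2 ℕ.* k) ℕ.* 3
  n-eq = ℕSolver.solve-∀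
  N-eq : ∀ k → 2 ℕ.* (1 ℕ.+ k ℕ.* 6) ≡ 2 ℕ.+ (2 ℕ.* (2 ℕ.* k)) ℕ.* 3
  N-eq = ℕSolver.solve-∀
  h-eq : ∀ k → k ℕ.* 6 ≡ (3 ℕ.* k) ℕ.* 2
  h-eq = ℕSolver.solve-∀
  h′-eq : ∀ k → (1 ℕ.+ k ℕ.* 6) ℕ.+ 1 ≡ suc (3 ℕ.* k) ℕ.* 2
  h′-eq = ℕSolver.solve-∀

congruent-p%6≡5 : ∀ {p} k → p ≡ 5 ℕ.+ k ℕ.* 6 → Prime p → ∀ t → InDp p t →
  Congruent p t (p ℕ./ 3) ((2 ℕ.* p) ℕ./ 3) ((p ∸ 1) ℕ./ 2) ((p ℕ.+ 1) ℕ./ 2) (legendre3 p)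
congruent-p%6≡5 {p} k refl p-prime t t∈Dp = Congruent-resp p t
  (/-unique 3 2 (suc (2 ℕ.* k)) (s≤s (s≤s (s≤s z≤n))) (n-eq k))
  (/-unique 3 1 (suc (2 ℕ.* suc (2 ℕ.* k))) (s≤s (s≤s z≤n)) (N-eq k))
  (/-unique 2 0 (2 ℕ.+ 3 ℕ.* k) (s≤s z≤n) (h-eq k))
  (/-unique 2 0 (3 ℕ.+ 3 ℕ.* k) (s≤s z≤n) (h′-eq k))
  (legendre3≡-1 p (trans (cong (ℕ._% 3) (n-eq k)) ([m+kn]%n≡m%n 2 (suc (2 ℕ.* k)) 3)))
  (congruent-5 k p-prime t t∈Dp)
  where
  n-eq : ∀ k → 5 ℕ.+ k ℕ.* 6 ≡ 2 ℕ.+ suc (2 ℕ.* k) ℕ.* 3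
  n-eq = ℕSolver.solve-∀
  N-eq : ∀ k → 2 ℕ.* (5 ℕ.+ k ℕ.* 6) ≡ 1 ℕ.+ suc (2 ℕ.* suc (2 ℕ.* k)) ℕ.* 3
  N-eq = ℕSolver.solve-∀
  h-eq : ∀ k → 4 ℕ.+ k ℕ.* 6 ≡ (2 ℕ.+ 3 ℕ.* k) ℕ.* 2
  h-eq = ℕSolver.solve-∀
  h′-eq : ∀ k → (5 ℕ.+ k ℕ.* 6) ℕ.+ 1 ≡ (3 ℕ.+ 3 ℕ.* k) ℕ.* 2
  h′-eq = ℕSolver.solve-∀

theorem11 : (p : ℕ) → Prime p → p > 3 → (t : ℚ) → InDp p t →
    (sumRange 0 (p ℕ./ 3) (λ k → catalan2 k * (t ^ℚ k))
    ≡ ℕtoℚ 3 * legendre3 p * w (p ℕ./ 3) (1ℚ - 27t/2 t) [modℚ p ])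
    × (sumRange ((p ∸ 1) ℕ./ 2) ((2 ℕ.* p) ℕ./ 3) (λ k → catalan2 k * (t ^ℚ k))
    ≡ - (legendre3 p * (w ((2 ℕ.* p) ℕ./ 3) (1ℚ - 27t/2 t) + w (p ℕ./ 3) (1ℚ - 27t/2 t))) [modℚ p ])
    × (sumRange 0 (p ℕ./ 3) (λ k → binom3 k * (t ^ℚ k))
    ≡ legendre3 p * w (p ℕ./ 3) (27t/2 t - 1ℚ) [modℚ p ])
    × (sumRange ((p ℕ.+ 1) ℕ./ 2) ((2 ℕ.* p) ℕ./ 3) (λ k → binom3 k * (t ^ℚ k))
    ≡ ((+ 1) / 3) * legendre3 p * (w ((2 ℕ.* p) ℕ./ 3) (27t/2 t - 1ℚ) - w (p ℕ./ 3) (27t/2 t - 1ℚ)) [modℚ p ])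
theorem11 p p-prime p>3 t t∈Dp = cases (prime-mod-6 p-prime p>3)
  where
  cases : (∃ λ k → p ≡ 1 ℕ.+ k ℕ.* 6 ⊎ p ≡ 5 ℕ.+ k ℕ.* 6) →
    Congruent p t (p ℕ./ 3) ((2 ℕ.* p) ℕ./ 3) ((p ∸ 1) ℕ./ 2) ((p ℕ.+ 1) ℕ./ 2) (legendre3 p)
  cases (k , inj₁ p≡1+6k) = congruent-p%6≡1 k p≡1+6k p-prime p>3 t t∈Dp
  cases (k , inj₂ p≡5+6k) = congruent-p%6≡5 k p≡5+6k p-prime t t∈Dp
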